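{- Let $d\ge2$ be an integer, let $c$ be a constant, let $G$ be the intersection graph of a $c$-fat collection of objects $\mathcal{O}$ in $\mathbb{R}^d$, and let $k$ be a positive integer. Then $G^{2k+1}$ is the intersection graph of a $(3^d(2k+1)^dc)$-fat collection of objects in $\mathbb{R}^d$. Moreover, given $G$ and $\mathcal{O}$, such a collection can be computed in time polynomial in $|V(G)|$.
   Context: An object in $\mathbb{R}^d$ is a path-connected compact set; its size is the side length of its smallest enclosing axis-aligned hypercube. A collection $\mathcal{O}$ of objects is $c$-fat if for every $r\in\mathbb{R}$ and every closed axis-aligned box $R$ of side length $r$ there are at most $c$ pairwise non-intersecting objects of $\mathcal{O}$ of size at least $r$ intersecting $R$. Its intersection graph has a vertex per object, two adjacent iff they intersect. For $p\in\mathbb{N}$, $G^p$ is the graph on $V(G)$ with distinct $u,v$ adjacent iff their distance in $G$ is at most $p$. Basic operations on objects (including forming unions) are assumed to take constant time. -}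

module Defs where

open import Algebra.Bundles using (CommutativeRing)
import Algebra.Definitions.RawMonoid as RawMonoidMult
open import Axiom.ExcludedMiddle using (ExcludedMiddle)
open import Data.Bool.Base using (if_then_else_)
open import Data.Fin.Base using (Fin; toℕ; fromℕ<)
open import Data.List.Base using (List; foldr; length)
open import Data.List.Relation.Unary.All using (All)
open import Data.List.Relation.Unary.AllPairs using (AllPairs)
open import Data.List.Relation.Unary.Any using (Any)
open import Data.Nat.Base as ℕ using (ℕ; zero; suc)
open import Data.Nat.Properties using (_<?_)
open import Data.Product.Base using (∃; ∃-syntax; _×_; _,_)
open import Function.Base using (_∘_)
open import Function.Bundles using (_⇔_)
open import Level using (0ℓ)
open import Relation.Binary.Core using (Rel)
open import Relation.Binary.Definitions using (Symmetric)
import Relation.Binary.Construct.NonStrictToStrict as ToStrict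
open import Relation.Binary.PropositionalEquality using (_≡_; _≢_)
open import Relation.Binary.Structures using (IsTotalOrder)
open import Relation.Nullary using (¬_; does; yes; no)
open import Relation.Unary using (Pred; _∈_; _⊆_; _∪_; ∅; Satisfiable)

-- The real numbers are taken axiomatically, as a Dedekind-complete totally
-- ordered field over a setoid.

record CompleteOrderedField : Set₁ where
  field
    commutativeRing : CommutativeRing 0ℓ 0ℓ

  open CommutativeRing commutativeRing public

  infix 4 _≤_
  field
    _≤_          : Rel Carrier 0ℓ
    isTotalOrder : IsTotalOrder _≈_ _≤_
    1≉0          : ¬ (1# ≈ 0#)
    inverse      : ∀ x → ¬ (x ≈ 0#) → ∃[ y ] x * y ≈ 1#
    +-monoˡ-≤    : ∀ z {x y} → x ≤ y → x + z ≤ y + z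
    *-nonNeg     : ∀ {x y} → 0# ≤ x → 0# ≤ y → 0# ≤ x * y
    supremum     : (S : Pred Carrier 0ℓ) → Satisfiable S →
                   ∃[ b ] (∀ x → x ∈ S → x ≤ b) →
                   ∃[ s ] (∀ x → x ∈ S → x ≤ s) ×
                          (∀ b → (∀ x → x ∈ S → x ≤ b) → s ≤ b)

  open ToStrict _≈_ _≤_ public using (_<_)

  fromℕ : ℕ → Carrier
  fromℕ m = RawMonoidMult._×_ +-rawMonoid m 1#

------------------------------------------------------------------------
-- Graphs

record Graph (n : ℕ) : Set₁ where
  field
    Adj    : Rel (Fin n) 0ℓ
    sym    : Symmetric Adj
    irrefl : ∀ {v} → ¬ Adj v v

data Walk {n} (G : Graph n) : Fin n → Fin n → ℕ → Set where
  nil  : ∀ {u} → Walk G u u 0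
  cons : ∀ {u v w m} → Graph.Adj G u v → Walk G v w m → Walk G u w (suc m)

-- Two vertices in different components are at no (finite) distance.
IsDistance : ∀ {n} → Graph n → Fin n → Fin n → ℕ → Set
IsDistance G u v m = Walk G u v m × (∀ m′ → Walk G u v m′ → m ℕ.≤ m′)

module _ {n} {G : Graph n} where
  open Graph G

  snoc : ∀ {u v w m} → Walk G u v m → Adj v w → Walk G u w (suc m)
  snoc nil        e = cons e nil
  snoc (cons a p) e = cons a (snoc p e)

  reverse : ∀ {u v m} → Walk G u v m → Walk G v u m
  reverse nil        = nil
  reverse (cons a p) = snoc (reverse p) (sym a)

power : ∀ {n} → Graph n → ℕ → Graph n
power G p = record
  { Adj    = λ u v → u ≢ v × ∃[ m ] IsDistance G u v m × m ℕ.≤ p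
  ; sym    = λ { (u≢v , m , (w , min) , m≤p) →
                 (λ { _≡_.refl → u≢v _≡_.refl })
                 , m , (reverse w , λ m′ → min m′ ∘ reverse) , m≤p }
  ; irrefl = λ { (v≢v , _) → v≢v _≡_.refl }
  }

------------------------------------------------------------------------
-- Objects in ℝᵈ

module Euclidean (ℝ : CompleteOrderedField) (d : ℕ) where
  open CompleteOrderedField ℝ hiding (sym)

  Point : Set
  Point = Fin d → Carrier

  Region : Set₁
  Region = Pred Point 0ℓ

  -- The ε-neighbourhood of x in the maximum norm.
  Near : Carrier → Point → Region
  Near ε x y = ∀ i → (x i < y i + ε) × (y i < x i + ε)

  IsOpen : Region → Set
  IsOpen U = ∀ x → x ∈ U → ∃[ ε ] 0# < ε × Near ε x ⊆ U

  IsCompact : Region → Set₁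
  IsCompact S = (I : Set) (U : I → Region) → (∀ i → IsOpen (U i)) →
                (∀ x → x ∈ S → ∃[ i ] x ∈ U i) →
                ∃[ is ] (∀ x → x ∈ S → Any (λ i → x ∈ U i) is)

  UnitInterval : Pred Carrier 0ℓ
  UnitInterval t = 0# ≤ t × t ≤ 1#

  -- Continuity of the restriction of γ to [0,1]; values elsewhere are ignored.
  IsContinuous : (Carrier → Point) → Set
  IsContinuous γ = ∀ t → t ∈ UnitInterval → ∀ ε → 0# < ε →
    ∃[ δ ] 0# < δ × (∀ s → s ∈ UnitInterval →
                     t < s + δ → s < t + δ → γ s ∈ Near ε (γ t))

  IsPathConnected : Region → Set
  IsPathConnected S = ∀ x y → x ∈ S → y ∈ S →
    ∃[ γ ] IsContinuous γ × (∀ t → t ∈ UnitInterval → γ t ∈ S) ×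
           (∀ i → γ 0# i ≈ x i) × (∀ i → γ 1# i ≈ y i)

  record IsObject (S : Region) : Set₁ where
    field
      -- S is a subset of the setoid ℝᵈ, i.e. closed under its equality.
      respects      : ∀ {x y} → (∀ i → x i ≈ y i) → x ∈ S → y ∈ S
      nonempty      : Satisfiable S
      pathConnected : IsPathConnected S
      compact       : IsCompact S

  -- The closed axis-aligned hypercube of side length r with least corner a
  -- (empty when r < 0 and d > 0).
  Cube : Point → Carrier → Region
  Cube a r x = ∀ i → (a i ≤ x i) × (x i ≤ a i + r)

  IsSize : Region → Carrier → Set
  IsSize S s = (∃[ a ] S ⊆ Cube a s) × (∀ a r → S ⊆ Cube a r → s ≤ r)

  SizeAtLeast : Carrier → Region → Set
  SizeAtLeast r S = ∃[ s ] IsSize S s × r ≤ s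

  Intersects : Region → Region → Set
  Intersects S T = ∃[ x ] x ∈ S × x ∈ T

  -- Collections are indexed families: distinct vertices may carry equal sets.
  Family : ℕ → Set₁
  Family n = Fin n → Region

  IsFat : ∀ {n} → Carrier → Family n → Set
  IsFat {n} c O = ∀ r (a : Point) (vs : List (Fin n)) →
    AllPairs (λ u v → ¬ Intersects (O u) (O v)) vs →
    All (λ v → SizeAtLeast r (O v) × Intersects (O v) (Cube a r)) vs →
    fromℕ (length vs) ≤ c

  IsIntersectionGraph : ∀ {n} → Graph n → Family n → Set
  IsIntersectionGraph G O =
    ∀ u v → Graph.Adj G u v ⇔ (u ≢ v × Intersects (O u) (O v))

  record IsFatRepresentation {n} (G : Graph n) (c : Carrier) (O : Family n) : Set₁ where
    field
      objects           : ∀ v → IsObject (O v)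
      intersectionGraph : IsIntersectionGraph G O
      fat               : IsFat c O

------------------------------------------------------------------------
-- Polynomial time
--
-- A unit-cost random access machine with numerical registers, a numerical
-- memory M and a memory Ω of subsets of ℝᵈ. The only arithmetic is addition and
-- truncated subtraction, so that unit cost is harmless. The arguments of an
-- instruction are registers; memory is addressed through register contents.

data Instr : Set where
  const         : (x m : ℕ) → Instr        -- x := m
  add sub       : (x y z : ℕ) → Instr      -- x := y + z, x := y ∸ z
  load          : (x y : ℕ) → Instr        -- x := M[y]
  store         : (x y : ℕ) → Instr        -- M[x] := y
  adjacent      : (x y z : ℕ) → Instr      -- x := [vertices y and z adjacent]
  copyObj       : (x y : ℕ) → Instr        -- Ω[x] := Ω[y]
  unionObj      : (x y z : ℕ) → Instr      -- Ω[x] := Ω[y] ∪ Ω[z]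
  intersectsObj : (x y z : ℕ) → Instr      -- x := [Ω[y] and Ω[z] intersect]

infixr 5 _⨾_

data Program : Set where
  skip   : Program
  instr  : Instr → Program
  _⨾_    : Program → Program → Program
  ifnz   : (x : ℕ) → Program → Program → Program
  while  : (x : ℕ) → Program → Program

-- Coefficients are listed from the constant term upwards.
evalPoly : List ℕ → ℕ → ℕ
evalPoly p m = foldr (λ a r → a ℕ.+ m ℕ.* r) 0 p

_[_↦_] : ∀ {ℓ} {A : Set ℓ} → (ℕ → A) → ℕ → A → (ℕ → A)
(f [ a ↦ v ]) b = if a ℕ.≡ᵇ b then v else f b

module Machine (lem : ExcludedMiddle 0ℓ) (ℝ : CompleteOrderedField) (d : ℕ) where
  open Euclidean ℝ d

  record State : Set₁ where
    constructor ⟨_,_,_⟩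
    field
      reg : ℕ → ℕ
      mem : ℕ → ℕ
      obj : ℕ → Region

  open State

  truth : Set → ℕ
  truth P = if does (lem {P}) then 1 else 0

  module _ {n} (G : Graph n) where

    exec : Instr → State → State
    exec i ⟨ R , M , Ω ⟩ = go i
      where
      set : ℕ → ℕ → State
      set x m = ⟨ R [ x ↦ m ] , M , Ω ⟩

      go : Instr → State
      go (const x m)           = set x m
      go (add x y z)           = set x (R y ℕ.+ R z)
      go (sub x y z)           = set x (R y ℕ.∸ R z)
      go (load x y)            = set x (M (R y))
      go (store x y)           = ⟨ R , M [ R x ↦ R y ] , Ω ⟩
      go (adjacent x y z)      = set x (truth (∃[ u ] ∃[ v ]
        toℕ u ≡ R y × toℕ v ≡ R z × Graph.Adj G u v))
      go (copyObj x y)         = ⟨ R , M , Ω [ R x ↦ Ω (R y) ] ⟩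
      go (unionObj x y z)      = ⟨ R , M , Ω [ R x ↦ Ω (R y) ∪ Ω (R z) ] ⟩
      go (intersectsObj x y z) = set x (truth (Intersects (Ω (R y)) (Ω (R z))))

    -- Run P σ t σ′: started in σ, P halts in σ′ after t steps.
    data Run : Program → State → ℕ → State → Set₁ where
      skip       : ∀ {σ} → Run skip σ 1 σ
      instr      : ∀ {i σ} → Run (instr i) σ 1 (exec i σ)
      seq        : ∀ {P Q σ σ′ σ″ s t} → Run P σ s σ′ → Run Q σ′ t σ″ →
                   Run (P ⨾ Q) σ (s ℕ.+ t) σ″
      if-nonzero : ∀ {x P Q σ σ′ t} → reg σ x ≢ 0 → Run P σ t σ′ →
                   Run (ifnz x P Q) σ (suc t) σ′
      if-zero    : ∀ {x P Q σ σ′ t} → reg σ x ≡ 0 → Run Q σ t σ′ →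
                   Run (ifnz x P Q) σ (suc t) σ′
      while-loop : ∀ {x P σ σ′ σ″ s t} → reg σ x ≢ 0 →
                   Run P σ s σ′ → Run (while x P) σ′ t σ″ →
                   Run (while x P) σ (suc (s ℕ.+ t)) σ″
      while-exit : ∀ {x P σ} → reg σ x ≡ 0 → Run (while x P) σ 1 σ

  -- Register 0 holds |V(G)|, register 1 holds k, and Ω[v] the object of v;
  -- everything else is 0 or empty. The graph is read by the instruction adjacent.
  input : ∀ {n} → ℕ → Family n → State
  input {n} k O = ⟨ R , (λ _ → 0) , Ω ⟩
    where
    R : ℕ → ℕ
    R 0 = n
    R 1 = k
    R _ = 0

    Ω : ℕ → Region
    Ω a with a <? n
    ... | yes a<n = O (fromℕ< a<n)
    ... | no  _   = ∅

  -- The result for v is read from Ω[n + v].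
  output : ∀ n → State → Family n
  output n σ v = obj σ (n ℕ.+ toℕ v)

{-# OPTIONS --safe #-}

-- The object of v in the new representation is the union O′(v) of the objects at distance at most k
-- from v; two such unions meet exactly when their centres are at distance at most 2k+1. For
-- fatness, put s = r/(2k+1). Any two points of O′(v) are linked by a chain of at most 2k+1
-- objects, so if O′(v) has size at least r and meets a cube R of side r, some member of size at
-- least s meets the cube of side 3r concentric with R. That cube is covered by 3^d (2k+1)^d cubes
-- of side s, each of which meets at most c of these pairwise disjoint members.

module Submission where

open import Defs
import Algebra.Definitions.RawMonoid as RawMonoidMult
import Algebra.Properties.Ring as RingProperties
import Algebra.Properties.Semiring.Mult as Mult
import Algebra.Solver.Ring.NaturalCoefficients.Default as Solver
open import Axiom.ExcludedMiddle using (ExcludedMiddle)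
open import Data.Bool.Base using (true; false; T)
open import Data.Empty using (⊥; ⊥-elim)
open import Data.Fin.Base using (Fin; zero; suc; toℕ; fromℕ<)
import Data.Fin.Properties as Finₚ
open import Data.List.Base using (List; []; _∷_; _++_; allFin; cartesianProductWith; filter; length; map)
open import Data.List.Membership.Propositional.Properties using (∈-allFin)
open import Data.List.Properties using (length-map; length-++)
open import Data.List.Relation.Unary.All as All using (All; []; _∷_)
import Data.List.Relation.Unary.All.Properties as Allₚ
open import Data.List.Relation.Unary.AllPairs as AllPairs using (AllPairs)
import Data.List.Relation.Unary.AllPairs.Properties as AllPairsₚ
open import Data.List.Relation.Unary.Any as Any using (Any; here; there)
import Data.List.Relation.Unary.Any.Properties as Anyₚ
open import Data.Nat.Base as ℕ using (ℕ; zero; suc; z≤n; s≤s)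
open import Data.Nat.Induction using (<-wellFounded)
import Data.Nat.Properties as ℕₚ
open import Data.Nat.Solver using (module +-*-Solver)
open import Data.Product.Base using (∃-syntax; Σ-syntax; _×_; _,_; proj₁; proj₂)
open import Data.Sum.Base using (_⊎_; inj₁; inj₂; [_,_]′)
open import Data.Unit.Base using (tt)
import Data.Vec.Functional as Vector
open import Function.Base using (_∘_; id)
open import Function.Bundles using (Equivalence; mk⇔)
open import Induction.WellFounded using (Acc; acc)
open import Level using (0ℓ)
open import Relation.Binary.Bundles using (Poset)
import Relation.Binary.Construct.NonStrictToStrict as ToStrict
open import Relation.Binary.PropositionalEquality as ≡ using (_≡_; _≢_)
import Relation.Binary.Reasoning.PartialOrder as PosetReasoning
open import Relation.Binary.Structures using (IsTotalOrder)
open import Relation.Nullary using (¬_; yes; no; ¬?)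
open import Relation.Unary using (Pred; _∈_; _⊆_; _≐_; _∪_; Satisfiable; Decidable)

-- The delicate point of fatness is locality: a large union meeting `R` might owe its size to
-- objects far from `R`, which no cube near `R` would count. So suppose that every member meeting
-- the `r`-neighbourhood of a point `x` of the union in `R` has size below `s`. There are finitely
-- many, so one `t < s` bounds their sizes. A chain from `x` moves away by at most `t` per object,
-- hence by at most `(2k+1)t < r` in all: it never reaches an object whose smallness is unknown. The
-- whole union is then near `x`, so all its members are small, and chains from an arbitrary point of
-- the union bound its diameter by `(2k+1)t < r`, contradicting its size. A neighbourhood of radius
-- `r` around a cube of side `r` is what produces the factor 3 per axis. Each chosen member lies
-- inside its union, so disjoint unions yield disjoint members.

-- Arithmetic and finite bounds in an ordered field

module OrderedField (lem : ExcludedMiddle 0ℓ) (ℝ : CompleteOrderedField) where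
  open CompleteOrderedField ℝ public hiding (zero)
  open IsTotalOrder isTotalOrder public
    using (total; antisym; ≤-respˡ-≈; ≤-respʳ-≈; isPartialOrder)
    renaming (refl to ≤-refl; trans to ≤-trans; reflexive to ≤-reflexive)
  open RawMonoidMult +-rawMonoid public using () renaming (_×_ to _⋆_)
  open Mult semiring public
    using (×-congʳ; ×-congˡ; ×-homo-+; ×-assocˡ; ×-assoc-*)
  open Solver commutativeSemiring public using (solve; _:+_; _:=_; con)

  poset : Poset 0ℓ 0ℓ 0ℓ
  poset = record { isPartialOrder = isPartialOrder }

  module ≤R = PosetReasoning poset

  <⇒≤ : ∀ {x y} → x < y → x ≤ y
  <⇒≤ = proj₁

  <-irrefl : ∀ {x} → ¬ (x < x)
  <-irrefl (_ , x≉x) = x≉x refl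

  ≤-<-trans : ∀ {x y z} → x ≤ y → y < z → x < z
  ≤-<-trans = ToStrict.≤-<-trans _≈_ _≤_ ≤-trans antisym ≤-respˡ-≈

  <-≤-trans : ∀ {x y z} → x < y → y ≤ z → x < z
  <-≤-trans = ToStrict.<-≤-trans _≈_ _≤_ sym ≤-trans antisym ≤-respʳ-≈

  <-resp-≈ : ∀ {x x′ y y′} → x ≈ x′ → y ≈ y′ → x < y → x′ < y′
  <-resp-≈ x≈x′ y≈y′ x<y =
    ≤-<-trans (≤-reflexive (sym x≈x′)) (<-≤-trans x<y (≤-reflexive y≈y′))

  ≤-resp-≈ : ∀ {x x′ y y′} → x ≈ x′ → y ≈ y′ → x ≤ y → x′ ≤ y′
  ≤-resp-≈ x≈x′ y≈y′ = ≤-respˡ-≈ x≈x′ ∘ ≤-respʳ-≈ y≈y′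

  ≤⊎> : ∀ x y → x ≤ y ⊎ y < x
  ≤⊎> x y with lem {x ≤ y}
  ... | yes x≤y = inj₁ x≤y
  ... | no  x≰y with total x y
  ...   | inj₁ x≤y = ⊥-elim (x≰y x≤y)
  ...   | inj₂ y≤x = inj₂ (y≤x , λ y≈x → x≰y (≤-reflexive (sym y≈x)))

  ≤⇒≯ : ∀ {x y} → x ≤ y → ¬ (y < x)
  ≤⇒≯ x≤y y<x = <-irrefl (≤-<-trans x≤y y<x)

  +-monoʳ-≤ : ∀ z {x y} → x ≤ y → z + x ≤ z + y
  +-monoʳ-≤ z = ≤-resp-≈ (+-comm _ z) (+-comm _ z) ∘ +-monoˡ-≤ z

  +-mono-≤ : ∀ {x y u v} → x ≤ y → u ≤ v → x + u ≤ y + v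
  +-mono-≤ x≤y u≤v = ≤-trans (+-monoˡ-≤ _ x≤y) (+-monoʳ-≤ _ u≤v)

  +-minus : ∀ x y → (x + y) - y ≈ x
  +-minus x y = trans (+-assoc x y (- y)) (trans (+-congˡ (-‿inverseʳ y)) (+-identityʳ x))

  minus-+ : ∀ x y → (x - y) + y ≈ x
  minus-+ x y = trans (+-assoc x (- y) y) (trans (+-congˡ (-‿inverseˡ y)) (+-identityʳ x))

  +-cancelʳ-≤ : ∀ z {x y} → x + z ≤ y + z → x ≤ y
  +-cancelʳ-≤ z = ≤-resp-≈ (+-minus _ z) (+-minus _ z) ∘ +-monoˡ-≤ (- z)

  +-cancelʳ-≈ : ∀ z {x y} → x + z ≈ y + z → x ≈ y
  +-cancelʳ-≈ z e = trans (sym (+-minus _ z)) (trans (+-congʳ e) (+-minus _ z))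

  +-monoˡ-< : ∀ z {x y} → x < y → x + z < y + z
  +-monoˡ-< z (x≤y , x≉y) = +-monoˡ-≤ z x≤y , x≉y ∘ +-cancelʳ-≈ z

  +-cancelʳ-< : ∀ z {x y} → x + z < y + z → x < y
  +-cancelʳ-< z (x≤y , x≉y) = +-cancelʳ-≤ z x≤y , x≉y ∘ +-congʳ

  +-mono-<-≤ : ∀ {x y u v} → x < y → u ≤ v → x + u < y + v
  +-mono-<-≤ x<y u≤v = <-≤-trans (+-monoˡ-< _ x<y) (+-monoʳ-≤ _ u≤v)

  +-mono-< : ∀ {x y u v} → x < y → u < v → x + u < y + v
  +-mono-< x<y u<v = +-mono-<-≤ x<y (<⇒≤ u<v)

  x<x+ε : ∀ x {ε} → 0# < ε → x < x + ε
  x<x+ε x 0<ε = <-resp-≈ (+-identityˡ x) (+-comm _ x) (+-monoˡ-< x 0<ε)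

  x<y⇒0<y-x : ∀ {x y} → x < y → 0# < y - x
  x<y⇒0<y-x {x} = <-resp-≈ (-‿inverseʳ x) refl ∘ +-monoˡ-< (- x)

  ≤-dense : ∀ {x y} → (∀ ε → 0# < ε → x < y + ε) → x ≤ y
  ≤-dense {x} {y} x<y+ε with ≤⊎> x y
  ... | inj₁ x≤y = x≤y
  ... | inj₂ y<x = ⊥-elim (<-irrefl (<-resp-≈ refl (trans (+-comm y _) (minus-+ x y))
                     (x<y+ε (x - y) (x<y⇒0<y-x y<x))))

  0≤1 : 0# ≤ 1#
  0≤1 with total 0# 1#
  ... | inj₁ 0≤1 = 0≤1
  ... | inj₂ 1≤0 = ≤-respʳ-≈ square (*-nonNeg 0≤-1 0≤-1)
    where
    0≤-1 : 0# ≤ - 1#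
    0≤-1 = ≤-resp-≈ (-‿inverseʳ 1#) (+-identityˡ (- 1#)) (+-monoˡ-≤ (- 1#) 1≤0)

    square : - 1# * - 1# ≈ 1#
    square = trans (-1*x≈-x (- 1#)) (-‿involutive 1#)
      where open RingProperties ring using (-1*x≈-x; -‿involutive)

  0<1 : 0# < 1#
  0<1 = 0≤1 , 1≉0 ∘ sym

  fromℕ-nonNeg : ∀ m → 0# ≤ fromℕ m
  fromℕ-nonNeg zero    = ≤-refl
  fromℕ-nonNeg (suc m) = ≤-respˡ-≈ (+-identityˡ 0#) (+-mono-≤ 0≤1 (fromℕ-nonNeg m))

  ⋆≈fromℕ* : ∀ m x → m ⋆ x ≈ fromℕ m * x
  ⋆≈fromℕ* m x = sym (trans (×-assoc-* m 1# x) (×-congʳ m (*-identityˡ x)))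

  -- The order makes every positive integer nonzero, hence invertible. This supplies both the side
  -- `r/(2k+1)` of the small cubes and the halved tolerances of the continuity proofs.
  divide : ∀ m x → ∃[ y ] suc m ⋆ y ≈ x
  divide m x with inverse (fromℕ (suc m)) suc≉0
    where
    0<suc : 0# < fromℕ (suc m)
    0<suc = <-resp-≈ (+-identityˡ 0#) refl (+-mono-<-≤ 0<1 (fromℕ-nonNeg m))

    suc≉0 : ¬ (fromℕ (suc m) ≈ 0#)
    suc≉0 = proj₂ 0<suc ∘ sym
  ... | z , mz≈1 = z * x , trans (⋆≈fromℕ* (suc m) (z * x))
                     (trans (sym (*-assoc _ z x)) (trans (*-congʳ mz≈1) (*-identityˡ x)))

  halve : ∀ {ε} → 0# < ε → ∃[ η ] 0# < η × η + η ≈ ε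
  halve {ε} 0<ε with divide 1 ε
  ... | η , 2η≈ε = η , 0<η , η+η≈ε
    where
    η+η≈ε : η + η ≈ ε
    η+η≈ε = trans (+-congˡ (sym (+-identityʳ η))) 2η≈ε

    0<η : 0# < η
    0<η with ≤⊎> η 0#
    ... | inj₂ 0<η = 0<η
    ... | inj₁ η≤0 = ⊥-elim (≤⇒≯ (≤-resp-≈ η+η≈ε (+-identityˡ 0#) (+-mono-≤ η≤0 η≤0)) 0<ε)

  ⋆-monoʳ-≤ : ∀ m {x y} → x ≤ y → m ⋆ x ≤ m ⋆ y
  ⋆-monoʳ-≤ zero    x≤y = ≤-refl
  ⋆-monoʳ-≤ (suc m) x≤y = +-mono-≤ x≤y (⋆-monoʳ-≤ m x≤y)

  ⋆-monoʳ-< : ∀ m {x y} → x < y → suc m ⋆ x < suc m ⋆ y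
  ⋆-monoʳ-< m x<y = +-mono-<-≤ x<y (⋆-monoʳ-≤ m (<⇒≤ x<y))

  ⋆-nonNeg : ∀ m {x} → 0# ≤ x → 0# ≤ m ⋆ x
  ⋆-nonNeg m 0≤x = ≤-respˡ-≈ (⋆-zero m) (⋆-monoʳ-≤ m 0≤x)
    where
    ⋆-zero : ∀ m → m ⋆ 0# ≈ 0#
    ⋆-zero zero    = refl
    ⋆-zero (suc m) = trans (+-identityˡ _) (⋆-zero m)

  ⋆-monoˡ-≤ : ∀ {m n x} → 0# ≤ x → m ℕ.≤ n → m ⋆ x ≤ n ⋆ x
  ⋆-monoˡ-≤ {n = n} 0≤x z≤n       = ⋆-nonNeg n 0≤x
  ⋆-monoˡ-≤         0≤x (s≤s m≤n) = +-monoʳ-≤ _ (⋆-monoˡ-≤ 0≤x m≤n)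

  min max : Carrier → Carrier → Carrier
  min x y with total x y
  ... | inj₁ _ = x
  ... | inj₂ _ = y
  max x y with total x y
  ... | inj₁ _ = y
  ... | inj₂ _ = x

  min≤ˡ : ∀ x y → min x y ≤ x
  min≤ˡ x y with total x y
  ... | inj₁ _   = ≤-refl
  ... | inj₂ y≤x = y≤x

  min≤ʳ : ∀ x y → min x y ≤ y
  min≤ʳ x y with total x y
  ... | inj₁ x≤y = x≤y
  ... | inj₂ _   = ≤-refl

  min-case : ∀ {P : Carrier → Set} {x y} → P x → P y → P (min x y)
  min-case {x = x} {y} px py with total x y
  ... | inj₁ _ = px
  ... | inj₂ _ = py

  max≥ˡ : ∀ x y → x ≤ max x y
  max≥ˡ x y with total x y
  ... | inj₁ x≤y = x≤y
  ... | inj₂ _   = ≤-refl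

  max≥ʳ : ∀ x y → y ≤ max x y
  max≥ʳ x y with total x y
  ... | inj₁ _   = ≤-refl
  ... | inj₂ y≤x = y≤x

  max-case : ∀ {P : Carrier → Set} {x y} → P x → P y → P (max x y)
  max-case {x = x} {y} px py with total x y
  ... | inj₁ _ = py
  ... | inj₂ _ = px

  list-upperBound : (xs : List Carrier) → ∃[ b ] (∀ {x} → Any (x ≤_) xs → x ≤ b)
  list-upperBound []       = 0# , λ ()
  list-upperBound (y ∷ ys) with list-upperBound ys
  ... | b , ≤b = max y b , λ where
    (here  x≤y) → ≤-trans x≤y (max≥ˡ y b)
    (there x≤)  → ≤-trans (≤b x≤) (max≥ʳ y b)

  finite-upperBound : ∀ {n} (f : Fin n → Carrier) → ∃[ b ] (∀ i → f i ≤ b)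
  finite-upperBound {zero}  f = 0# , λ ()
  finite-upperBound {suc n} f with finite-upperBound (f ∘ suc)
  ... | b , ≤b = max (f zero) b , λ where
    zero    → max≥ˡ (f zero) b
    (suc i) → ≤-trans (≤b i) (max≥ʳ (f zero) b)

  -- The maximum of finitely many values below `s` is still below `s`; `s - 1#` serves as the
  -- starting value, so that an empty selection needs no separate statement.
  finite-strictBound : ∀ {n} (P : Pred (Fin n) 0ℓ) (f : Fin n → Carrier) s →
                       (∀ i → i ∈ P → f i < s) →
                       ∃[ b ] b < s × (∀ i → i ∈ P → f i ≤ b)
  finite-strictBound {zero}  P f s f<s =
    s - 1# , <-resp-≈ refl (minus-+ s 1#) (x<x+ε (s - 1#) 0<1) , λ ()
  finite-strictBound {suc n} P f s f<s
    with finite-strictBound (P ∘ suc) (f ∘ suc) s (f<s ∘ suc) | lem {zero ∈ P}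
  ... | b , b<s , ≤b | no 0∉P = b , b<s , λ where
    zero    0∈P → ⊥-elim (0∉P 0∈P)
    (suc i) i∈P → ≤b i i∈P
  ... | b , b<s , ≤b | yes 0∈P = max (f zero) b , max-case {_< s} (f<s zero 0∈P) b<s , λ where
    zero    _   → max≥ˡ (f zero) b
    (suc i) i∈P → ≤-trans (≤b i i∈P) (max≥ʳ (f zero) b)

-- Walks, balls and shortest walks

module Walks (lem : ExcludedMiddle 0ℓ) {n : ℕ} (G : Graph n) where
  open Graph G

  Ball : ℕ → Fin n → Pred (Fin n) 0ℓ
  Ball k v u = ∃[ m ] Walk G v u m × m ℕ.≤ k

  ball-centre : ∀ k v → v ∈ Ball k v
  ball-centre k v = 0 , nil , z≤n

  ball-sym : ∀ {k u v} → u ∈ Ball k v → v ∈ Ball k u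
  ball-sym (m , p , m≤k) = m , reverse p , m≤k

  ball-zero : ∀ {u v} → u ∈ Ball 0 v → v ≡ u
  ball-zero (_ , nil , z≤n) = ≡.refl

  ball-mono : ∀ {k l u v} → k ℕ.≤ l → u ∈ Ball k v → u ∈ Ball l v
  ball-mono k≤l (m , p , m≤k) = m , p , ℕₚ.≤-trans m≤k k≤l

  ball-cons : ∀ {k u v w} → Adj u v → w ∈ Ball k v → w ∈ Ball (suc k) u
  ball-cons e (m , p , m≤k) = suc m , cons e p , s≤s m≤k

  ball-uncons : ∀ {k u w} → w ∈ Ball (suc k) u →
                w ∈ Ball k u ⊎ (∃[ v ] Adj u v × w ∈ Ball k v)
  ball-uncons (_ , nil      , _)       = inj₁ (0 , nil , z≤n)
  ball-uncons (_ , cons e p , s≤s m≤k) = inj₂ (_ , e , _ , p , m≤k)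

  append : ∀ {H : Graph n} {u v w l m} → Walk H u v l → Walk H v w m → Walk H u w (l ℕ.+ m)
  append nil        q = q
  append (cons e p) q = cons e (append p q)

  ball-trans : ∀ {k l u v w} → v ∈ Ball k u → w ∈ Ball l v → w ∈ Ball (k ℕ.+ l) u
  ball-trans (_ , p , m≤k) (_ , q , m≤l) = _ , append p q , ℕₚ.+-mono-≤ m≤k m≤l

  ball-split : ∀ k {l u w} → w ∈ Ball (k ℕ.+ l) u → ∃[ v ] v ∈ Ball k u × w ∈ Ball l v
  ball-split zero    w∈B = _ , ball-centre 0 _ , w∈B
  ball-split (suc k) (_ , nil      , _)       = _ , ball-centre (suc k) _ , ball-centre _ _
  ball-split (suc k) (_ , cons e p , s≤s m≤)  with ball-split k (_ , p , m≤)
  ... | v , v∈B , w∈B = v , ball-cons e v∈B , w∈B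

  -- Descent on the length: as long as a shorter walk exists, pass to it. This turns the bounded
  -- walks that define `Ball` into the exact distances that `power` asks for.
  distance : ∀ {u v m} → Walk G u v m → ∃[ l ] IsDistance G u v l × l ℕ.≤ m
  distance = go (<-wellFounded _)
    where
    go : ∀ {u v m} → Acc ℕ._<_ m → Walk G u v m → ∃[ l ] IsDistance G u v l × l ℕ.≤ m
    go {u} {v} {m} (acc rec) p with lem {∃[ m′ ] m′ ℕ.< m × Walk G u v m′}
    ... | no ¬shorter =
      m , (p , λ m′ q → ℕₚ.≮⇒≥ λ m′<m → ¬shorter (m′ , m′<m , q)) , ℕₚ.≤-refl
    ... | yes (m′ , m′<m , q) with go (rec m′<m) q
    ...   | l , dist , l≤m′ = l , dist , ℕₚ.≤-trans l≤m′ (ℕₚ.<⇒≤ m′<m)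

  private
    vertex : ∀ {u v m} → Walk G u v m → Fin (suc m) → Fin n
    vertex {u} p          zero    = u
    vertex     (cons _ p) (suc i) = vertex p i

    drop : ∀ {u v m} (p : Walk G u v m) i → ∃[ l ] l ℕ.+ toℕ i ≡ m × Walk G (vertex p i) v l
    drop {m = m} p     zero    = m , ℕₚ.+-identityʳ m , p
    drop (cons _ p)    (suc i) with drop p i
    ... | l , l+i≡m , q = l , ≡.trans (ℕₚ.+-suc l (toℕ i)) (≡.cong suc l+i≡m) , q

    -- Cuts out the closed part between two visits to the same vertex.
    splice : ∀ {u v m} (p : Walk G u v m) i j → toℕ i ℕ.< toℕ j → vertex p i ≡ vertex p j →
             ∃[ l ] l ℕ.< m × Walk G u v l
    splice {v = v} p zero (suc j) _ eq with drop p (suc j)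
    ... | l , l+j≡m , q =
      l , ≡.subst (l ℕ.<_) l+j≡m (ℕₚ.m<m+n l (s≤s z≤n)) , ≡.subst (λ w → Walk G w v l) (≡.sym eq) q
    splice (cons e p) (suc i) (suc j) (s≤s i<j) eq with splice p i j i<j eq
    ... | l , l<m , q = suc l , s≤s l<m , cons e q

  -- A walk with at least `n` edges lists more than `n` vertices, so one repeats and `splice`
  -- shortens the walk.
  distance<n : ∀ {u v m} → IsDistance G u v m → m ℕ.< n
  distance<n {m = m} (p , minimal) with m ℕₚ.<? n
  ... | yes m<n = m<n
  ... | no  m≮n with Finₚ.pigeonhole (s≤s (ℕₚ.≮⇒≥ m≮n)) (vertex p)
  ...   | i , j , i<j , eq with splice p i j i<j eq
  ...     | l , l<m , q = ⊥-elim (ℕₚ.<⇒≱ l<m (minimal l q))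

  -- `n ∸ (n ∸ k)` is the minimum of `k` and `n`, written with the truncated subtraction of the
  -- machine. When `k` exceeds `n` it equals `n`, and by `distance<n` a shortest walk still fits.
  ball-⊓ : ∀ {k u v} → u ∈ Ball k v → u ∈ Ball (n ℕ.∸ (n ℕ.∸ k)) v
  ball-⊓ {k} (m , p , m≤k) with distance p
  ... | l , dist , l≤m = l , proj₁ dist , l≤
    where
    l≤ : l ℕ.≤ n ℕ.∸ (n ℕ.∸ k)
    l≤ with ℕₚ.≤-total k n
    ... | inj₁ k≤n = ℕₚ.≤-trans l≤m (ℕₚ.≤-trans m≤k (ℕₚ.≤-reflexive (≡.sym (ℕₚ.m∸[m∸n]≡n k≤n))))
    ... | inj₂ n≤k rewrite ℕₚ.m≤n⇒m∸n≡0 n≤k = ℕₚ.<⇒≤ (distance<n dist)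

  ball-⊓⁻ : ∀ {k u v} → u ∈ Ball (n ℕ.∸ (n ℕ.∸ k)) v → u ∈ Ball k v
  ball-⊓⁻ {k} = ball-mono n∸[n∸k]≤k
    where
    n∸[n∸k]≤k : n ℕ.∸ (n ℕ.∸ k) ℕ.≤ k
    n∸[n∸k]≤k = ℕₚ.m≤n+o⇒m∸n≤o n (n ℕ.∸ k) (ℕₚ.≤-trans (ℕₚ.m≤n+m∸n n k) (ℕₚ.≤-reflexive (ℕₚ.+-comm k _)))

  ball⇒power-adj : ∀ {k u v} → u ≢ v → v ∈ Ball k u → Graph.Adj (power G k) u v
  ball⇒power-adj u≢v (m , p , m≤k) with distance p
  ... | l , dist , l≤m = u≢v , l , dist , ℕₚ.≤-trans l≤m m≤k

  induced : Pred (Fin n) 0ℓ → Graph n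
  induced P = record
    { Adj    = λ u v → Adj u v × u ∈ P × v ∈ P
    ; sym    = λ { (e , u∈P , v∈P) → sym e , v∈P , u∈P }
    ; irrefl = irrefl ∘ proj₁
    }

  -- The walk goes through the centre. Every prefix of a walk of length at most `k` from the centre
  -- ends in the ball, so neither half leaves it; `inside` carries that prefix along as the
  -- certificate. At most `k + k` edges means at most 2k+1 objects.
  ball-connected : ∀ {k v u w} → u ∈ Ball k v → w ∈ Ball k v →
                   ∃[ m ] m ℕ.≤ k ℕ.+ k × Walk (induced (Ball k v)) u w m
  ball-connected {k} {v} (i , p , i≤k) (j , q , j≤k) =
    i ℕ.+ j , ℕₚ.+-mono-≤ i≤k j≤k , append (reverse (inside nil p i≤k)) (inside nil q j≤k)
    where
    inside : ∀ {a u i j} → Walk G v a i → Walk G a u j → i ℕ.+ j ℕ.≤ k →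
             Walk (induced (Ball k v)) a u j
    inside p nil _ = nil
    inside {i = i} {suc j} p (cons e q) i+j≤k =
      cons (e , (i , p , ℕₚ.≤-trans (ℕₚ.m≤m+n i _) i+j≤k)
              , (suc i , snoc p e , ℕₚ.≤-trans (ℕₚ.m≤m+n (suc i) j) i+j≤k′))
           (inside (snoc p e) q i+j≤k′)
      where
      i+j≤k′ : suc i ℕ.+ j ℕ.≤ k
      i+j≤k′ = ≡.subst (ℕ._≤ k) (ℕₚ.+-suc i j) i+j≤k

-- Concatenation of continuous paths

module Paths (lem : ExcludedMiddle 0ℓ) (ℝ : CompleteOrderedField) (d : ℕ) where
  open OrderedField lem ℝ
  open Euclidean ℝ d

  Joined : Region → Point → Point → Set
  Joined S x y = ∃[ γ ] IsContinuous γ × (∀ t → t ∈ UnitInterval → γ t ∈ S) ×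
                        (∀ i → γ 0# i ≈ x i) × (∀ i → γ 1# i ≈ y i)

  joined-mono : ∀ {S T x y} → S ⊆ T → Joined S x y → Joined T x y
  joined-mono S⊆T (γ , cont , γ∈S , ends) = γ , cont , (λ t t∈I → S⊆T (γ∈S t t∈I)) , ends

  0∈I : 0# ∈ UnitInterval
  0∈I = ≤-refl , 0≤1

  1∈I : 1# ∈ UnitInterval
  1∈I = 0≤1 , ≤-refl

  -- A function on the carrier need not respect `≈`, but continuity forces it: equal times are
  -- within every `δ` of each other, so the values are within every `ε`.
  continuous-cong : ∀ {γ} → IsContinuous γ → ∀ {s t} → s ∈ UnitInterval → t ∈ UnitInterval →
                    s ≈ t → ∀ i → γ s i ≈ γ t i
  continuous-cong {γ} cont {s} {t} s∈I t∈I s≈t i =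
    antisym (≤-dense λ ε 0<ε → proj₂ (near ε 0<ε i)) (≤-dense λ ε 0<ε → proj₁ (near ε 0<ε i))
    where
    near : ∀ ε → 0# < ε → γ s ∈ Near ε (γ t)
    near ε 0<ε with cont t t∈I ε 0<ε
    ... | δ , 0<δ , close = close s s∈I
      (<-resp-≈ refl (+-congʳ (sym s≈t)) (x<x+ε t 0<δ))
      (<-resp-≈ (sym s≈t) refl (x<x+ε t 0<δ))

  -- First and second half of the time interval, each clamped to [0,1].
  early late : Carrier → Carrier
  early t = min (t + t) 1#
  late  t = max (t + t) 1# - 1#

  -- The second clause is the Lipschitz condition with constant 2 in one-sided form; used for both
  -- orders of `s` and `t`, it replaces a bound on an absolute value.
  IsReparametrisation : (Carrier → Carrier) → Set
  IsReparametrisation φ =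
    (∀ t → t ∈ UnitInterval → φ t ∈ UnitInterval) ×
    (∀ {s t η} → 0# < η → s < t + η → φ s < φ t + (η + η))

  doubled : ∀ {s t η} → s < t + η → s + s < (t + t) + (η + η)
  doubled {s} {t} {η} s<t+η =
    <-resp-≈ refl (solve 2 (λ t η → (t :+ η) :+ (t :+ η) := (t :+ t) :+ (η :+ η)) refl t η)
      (+-mono-< s<t+η s<t+η)

  0<η+η : ∀ {η} → 0# < η → 0# < η + η
  0<η+η 0<η = <-resp-≈ (+-identityˡ 0#) refl (+-mono-< 0<η 0<η)

  0≤t+t : ∀ {t} → 0# ≤ t → 0# ≤ t + t
  0≤t+t 0≤t = ≤-respˡ-≈ (+-identityˡ 0#) (+-mono-≤ 0≤t 0≤t)

  early-reparametrisation : IsReparametrisation early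
  early-reparametrisation =
    (λ t (0≤t , _) → min-case {0# ≤_} (0≤t+t 0≤t) 0≤1 , min≤ʳ (t + t) 1#) ,
    λ {s} {t} {η} 0<η s<t+η → min-case {λ m → early s < m + (η + η)}
      (≤-<-trans (min≤ˡ (s + s) 1#) (doubled s<t+η))
      (≤-<-trans (min≤ʳ (s + s) 1#) (x<x+ε 1# (0<η+η 0<η)))

  late-reparametrisation : IsReparametrisation late
  late-reparametrisation =
    (λ t (_ , t≤1) →
      ≤-respˡ-≈ (-‿inverseʳ 1#) (+-monoˡ-≤ (- 1#) (max≥ʳ (t + t) 1#)) ,
      ≤-respʳ-≈ (+-minus 1# 1#) (+-monoˡ-≤ (- 1#)
        (max-case {_≤ 1# + 1#} (+-mono-≤ t≤1 t≤1) (<⇒≤ (x<x+ε 1# 0<1))))) ,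
    λ {s} {t} {η} 0<η s<t+η →
      <-resp-≈ refl (solve 3 (λ m η z → (m :+ η) :+ z := (m :+ z) :+ η) refl
                       (max (t + t) 1#) (η + η) (- 1#))
      (+-monoˡ-< (- 1#) (max-case {λ m → m < max (t + t) 1# + (η + η)}
        (<-≤-trans (doubled s<t+η) (+-monoˡ-≤ (η + η) (max≥ˡ (t + t) 1#)))
        (<-≤-trans (x<x+ε 1# (0<η+η 0<η)) (+-monoˡ-≤ (η + η) (max≥ʳ (t + t) 1#)))))

  reparametrise : ∀ {φ γ} → IsReparametrisation φ → IsContinuous γ → IsContinuous (γ ∘ φ)
  reparametrise {φ} (into , lipschitz) cont t t∈I ε 0<ε with cont (φ t) (into t t∈I) ε 0<ε
  ... | δ , 0<δ , close with halve 0<δ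
  ...   | η , 0<η , η+η≈δ = η , 0<η , λ s s∈I t<s+η s<t+η →
    close (φ s) (into s s∈I)
      (<-resp-≈ refl (+-congˡ η+η≈δ) (lipschitz 0<η t<s+η))
      (<-resp-≈ refl (+-congˡ η+η≈δ) (lipschitz 0<η s<t+η))

  continuous-+ : ∀ {γ γ′} → IsContinuous γ → IsContinuous γ′ → ∀ (z : Point) →
                 IsContinuous (λ t i → (γ t i + γ′ t i) + z i)
  continuous-+ {γ} {γ′} cont cont′ z t t∈I ε 0<ε with halve 0<ε
  ... | η , 0<η , η+η≈ε with cont t t∈I η 0<η | cont′ t t∈I η 0<η
  ...   | δ , 0<δ , close | δ′ , 0<δ′ , close′ =
    min δ δ′ , min-case {0# <_} 0<δ 0<δ′ , λ s s∈I t<s+δ s<t+δ i →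
      let near  = close  s s∈I (<-≤-trans t<s+δ (+-monoʳ-≤ s (min≤ˡ δ δ′)))
                               (<-≤-trans s<t+δ (+-monoʳ-≤ t (min≤ˡ δ δ′))) i
          near′ = close′ s s∈I (<-≤-trans t<s+δ (+-monoʳ-≤ s (min≤ʳ δ δ′)))
                               (<-≤-trans s<t+δ (+-monoʳ-≤ t (min≤ʳ δ δ′))) i
      in shift (proj₁ near) (proj₁ near′) , shift (proj₂ near) (proj₂ near′)
    where
    shift : ∀ {a a′ b b′ w} → a < b + η → a′ < b′ + η → (a + a′) + w < ((b + b′) + w) + ε
    shift {b = b} {b′} {w} a<b a′<b′ = <-resp-≈ refl
      (trans (solve 4 (λ b b′ w η → ((b :+ η) :+ (b′ :+ η)) :+ w := ((b :+ b′) :+ w) :+ (η :+ η))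
                refl b b′ w η) (+-congˡ η+η≈ε))
      (+-monoˡ-< w (+-mono-< a<b a′<b′))

  -- The path γ(early t) + γ′(late t) − y runs through γ while late t = 0 and through γ′ once
  -- early t = 1; its continuity needs no case distinction.
  joined-trans : ∀ {S x y z} → (∀ {p q} → (∀ i → p i ≈ q i) → p ∈ S → q ∈ S) →
                 Joined S x y → Joined S y z → Joined S x z
  joined-trans {S} {x} {y} {z} respects (γ , cont , γ∈S , γ0 , γ1) (γ′ , cont′ , γ′∈S , γ′0 , γ′1) =
    path , continuous-+ (reparametrise early-reparametrisation cont)
                        (reparametrise late-reparametrisation cont′) (-_ ∘ y) ,
    path∈S ,
    (λ i → trans (pathˡ 0∈I (late≈0 0+0≤1) i)
             (trans (continuous-cong cont (early∈I 0∈I) 0∈I early0 i) (γ0 i))) ,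
    (λ i → trans (pathʳ 1∈I (early≈1 1≤1+1) i)
             (trans (continuous-cong cont′ (late∈I 1∈I) 1∈I late1 i) (γ′1 i)))
    where
    path : Carrier → Point
    path t i = (γ (early t) i + γ′ (late t) i) - y i

    early∈I : ∀ {t} → t ∈ UnitInterval → early t ∈ UnitInterval
    early∈I = proj₁ early-reparametrisation _

    late∈I : ∀ {t} → t ∈ UnitInterval → late t ∈ UnitInterval
    late∈I = proj₁ late-reparametrisation _

    early≈1 : ∀ {t} → 1# ≤ t + t → early t ≈ 1#
    early≈1 {t} 1≤ = antisym (min≤ʳ (t + t) 1#) (min-case {1# ≤_} 1≤ ≤-refl)

    late≈0 : ∀ {t} → t + t ≤ 1# → late t ≈ 0#
    late≈0 {t} ≤1 = trans (+-congʳ (antisym (max-case {_≤ 1#} ≤1 ≤-refl) (max≥ʳ (t + t) 1#)))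
                      (-‿inverseʳ 1#)

    0+0≤1 : 0# + 0# ≤ 1#
    0+0≤1 = ≤-respˡ-≈ (sym (+-identityˡ 0#)) 0≤1

    1≤1+1 : 1# ≤ 1# + 1#
    1≤1+1 = <⇒≤ (x<x+ε 1# 0<1)

    early0 : early 0# ≈ 0#
    early0 = antisym (≤-respʳ-≈ (+-identityˡ 0#) (min≤ˡ (0# + 0#) 1#)) (proj₁ (early∈I 0∈I))

    late1 : late 1# ≈ 1#
    late1 = trans (+-congʳ (antisym (max-case {_≤ 1# + 1#} ≤-refl 1≤1+1) (max≥ˡ (1# + 1#) 1#)))
              (+-minus 1# 1#)

    pathˡ : ∀ {t} → t ∈ UnitInterval → late t ≈ 0# → ∀ i → path t i ≈ γ (early t) i
    pathˡ t∈I late≈0 i = trans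
      (+-congʳ (+-congˡ (trans (continuous-cong cont′ (late∈I t∈I) 0∈I late≈0 i) (γ′0 i))))
      (+-minus _ (y i))

    pathʳ : ∀ {t} → t ∈ UnitInterval → early t ≈ 1# → ∀ i → path t i ≈ γ′ (late t) i
    pathʳ t∈I early≈1 i = trans
      (+-congʳ (trans (+-congʳ (trans (continuous-cong cont (early∈I t∈I) 1∈I early≈1 i) (γ1 i)))
                      (+-comm (y i) _)))
      (+-minus _ (y i))

    path∈S : ∀ t → t ∈ UnitInterval → path t ∈ S
    path∈S t t∈I =
      [ (λ ≤1 → respects (λ i → sym (pathˡ t∈I (late≈0 ≤1) i)) (γ∈S (early t) (early∈I t∈I)))
      , (λ 1≤ → respects (λ i → sym (pathʳ t∈I (early≈1 1≤) i)) (γ′∈S (late t) (late∈I t∈I)))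
      ]′ (total (t + t) 1#)

-- List lengths and grids of cubes

length-cartesianProductWith : ∀ {A B C : Set} (f : A → B → C) xs ys →
  length (cartesianProductWith f xs ys) ≡ length xs ℕ.* length ys
length-cartesianProductWith f []       ys = ≡.refl
length-cartesianProductWith f (x ∷ xs) ys = ≡.trans (length-++ (map (f x) ys))
  (≡.cong₂ ℕ._+_ (length-map (f x) ys) (length-cartesianProductWith f xs ys))

length-filter-complement : ∀ {A : Set} {P : Pred A 0ℓ} (P? : Decidable P) xs →
  length xs ≡ length (filter P? xs) ℕ.+ length (filter (¬? ∘ P?) xs)
length-filter-complement P? [] = ≡.refl
length-filter-complement P? (x ∷ xs) with P? x
... | yes _ = ≡.cong suc (length-filter-complement P? xs)
... | no  _ = ≡.trans (≡.cong suc (length-filter-complement P? xs)) (≡.sym (ℕₚ.+-suc _ _))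

module Grid (lem : ExcludedMiddle 0ℓ) (ℝ : CompleteOrderedField) where
  open OrderedField lem ℝ

  offsets : ℕ → Carrier → Carrier → List Carrier
  offsets zero    b s = []
  offsets (suc m) b s = b ∷ offsets m (b + s) s

  length-offsets : ∀ m b s → length (offsets m b s) ≡ m
  length-offsets zero    b s = ≡.refl
  length-offsets (suc m) b s = ≡.cong suc (length-offsets m (b + s) s)

  offsets-cover : ∀ m b s x → b ≤ x → x ≤ b + suc m ⋆ s →
                  Any (λ p → p ≤ x × x ≤ p + s) (offsets (suc m) b s)
  offsets-cover zero    b s x b≤x x≤ = here (b≤x , ≤-respʳ-≈ (+-congˡ (+-identityʳ s)) x≤)
  offsets-cover (suc m) b s x b≤x x≤ with total x (b + s)
  ... | inj₁ x≤b+s = here (b≤x , x≤b+s)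
  ... | inj₂ b+s≤x = there (offsets-cover m (b + s) s x b+s≤x (≤-respʳ-≈ (sym (+-assoc b s _)) x≤))

  grid : ∀ {d} → ℕ → (Fin d → Carrier) → Carrier → List (Fin d → Carrier)
  grid {zero}  m b s = (λ ()) ∷ []
  grid {suc d} m b s = cartesianProductWith Vector._∷_ (offsets m (b zero) s) (grid m (b ∘ suc) s)

  length-grid : ∀ {d} m (b : Fin d → Carrier) s → length (grid m b s) ≡ m ℕ.^ d
  length-grid {zero}  m b s = ≡.refl
  length-grid {suc d} m b s = ≡.trans (length-cartesianProductWith Vector._∷_ (offsets m (b zero) s) _)
    (≡.cong₂ ℕ._*_ (length-offsets m (b zero) s) (length-grid m (b ∘ suc) s))

  grid-cover : ∀ {d} m (b : Fin d → Carrier) s (x : Fin d → Carrier) →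
               (∀ i → b i ≤ x i × x i ≤ b i + suc m ⋆ s) →
               Any (λ p → ∀ i → p i ≤ x i × x i ≤ p i + s) (grid (suc m) b s)
  grid-cover {zero}  m b s x bounds = here λ ()
  grid-cover {suc d} m b s x bounds = Anyₚ.cartesianProductWith⁺ Vector._∷_
    (λ { px qx zero → px ; px qx (suc i) → qx i })
    (offsets-cover m (b zero) s (x zero) (proj₁ (bounds zero)) (proj₂ (bounds zero)))
    (grid-cover m (b ∘ suc) s (x ∘ suc) (bounds ∘ suc))

-- Size as diameter in the maximum norm, and counting by cubes

module Sizes (lem : ExcludedMiddle 0ℓ) (ℝ : CompleteOrderedField) (d : ℕ) where
  open OrderedField lem ℝ
  open Euclidean ℝ d

  -- A one-sided inequality is enough, since `y` and `z` may be exchanged.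
  Diameter≤ : Region → Carrier → Set
  Diameter≤ S e = ∀ {y z} → y ∈ S → z ∈ S → ∀ i → y i ≤ z i + e

  cube⇒diameter : ∀ {S a e} → S ⊆ Cube a e → Diameter≤ S e
  cube⇒diameter {a = a} {e} S⊆C y∈S z∈S i =
    ≤-trans (proj₂ (S⊆C y∈S i)) (+-monoˡ-≤ e (proj₁ (S⊆C z∈S i)))

  -- In each coordinate the corner is the supremum minus `e`. It is a lower bound because `y i + e`
  -- bounds the coordinate from above for every `y` in `S`; thus no infimum is taken.
  diameter⇒cube : ∀ {S e} → Satisfiable S → Diameter≤ S e → ∃[ a ] S ⊆ Cube a e
  diameter⇒cube {S} {e} (x , x∈S) diam = (λ i → top i - e) , λ {y} y∈S i →
    +-cancelʳ-≤ e (≤-respˡ-≈ (sym (minus-+ (top i) e))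
      (least i (y i + e) λ { _ (z , z∈S , c≈z) → ≤-respˡ-≈ (sym c≈z) (diam z∈S y∈S i) })) ,
    ≤-respʳ-≈ (sym (minus-+ (top i) e)) (upper i (y i) (y , y∈S , refl))
    where
    Coordinate : Fin d → Pred Carrier 0ℓ
    Coordinate i c = ∃[ z ] z ∈ S × c ≈ z i

    sup : ∀ i → _
    sup i = supremum (Coordinate i) (x i , x , x∈S , refl)
      (x i + e , λ { _ (z , z∈S , c≈z) → ≤-respˡ-≈ (sym c≈z) (diam z∈S x∈S i) })

    top : Point
    top i = proj₁ (sup i)

    upper : ∀ i c → c ∈ Coordinate i → c ≤ top i
    upper i = proj₁ (proj₂ (sup i))

    least : ∀ i b → (∀ c → c ∈ Coordinate i → c ≤ b) → top i ≤ b
    least i = proj₂ (proj₂ (sup i))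

  size≤ : ∀ {S s e} → Satisfiable S → IsSize S s → Diameter≤ S e → s ≤ e
  size≤ S≠∅ (_ , minimal) diam with diameter⇒cube S≠∅ diam
  ... | a , S⊆C = minimal a _ S⊆C

  -- The half-spaces `x i < c` form an open cover, and the largest `c` of a finite subcover is a
  -- bound. `compact⇒below` does the same with `0# < x i + c`.
  compact⇒above : ∀ {S} → IsCompact S → ∀ i → ∃[ b ] (∀ {x} → x ∈ S → x i ≤ b)
  compact⇒above {S} compact i
    with compact Carrier (λ c x → x i < c)
           (λ c x x<c → c - x i , x<y⇒0<y-x x<c , λ {y} near →
             <-resp-≈ refl (trans (+-comm (x i) _) (minus-+ c (x i))) (proj₂ (near i)))
           (λ x _ → x i + 1# , x<x+ε (x i) 0<1)
  ... | cs , covers with list-upperBound cs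
  ...   | b , ≤b = b , λ {x} x∈S → ≤b (Any.map <⇒≤ (covers x x∈S))

  compact⇒below : ∀ {S} → IsCompact S → ∀ i → ∃[ b ] (∀ {x} → x ∈ S → 0# ≤ x i + b)
  compact⇒below {S} compact i
    with compact Carrier (λ c x → 0# < x i + c)
           (λ c x 0<x+c → x i + c , 0<x+c , λ {y} near →
             +-cancelʳ-< (x i) (<-resp-≈ (sym (+-identityˡ (x i)))
               (solve 3 (λ x y c → y :+ (x :+ c) := (y :+ c) :+ x) refl (x i) (y i) c)
               (proj₁ (near i))))
           (λ x _ → (- x i) + 1# , <-resp-≈ refl
             (trans (sym (+-identityˡ 1#)) (trans (+-congʳ (sym (-‿inverseʳ (x i)))) (+-assoc _ _ _)))
             0<1)
  ... | cs , covers with list-upperBound cs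
  ...   | b , ≤b = b , λ {x} x∈S → shift (≤b (Any.map (λ {c} → unshift c) (covers x x∈S)))
    where
    unshift : ∀ {a} c → 0# < a + c → - a ≤ c
    unshift {a} c 0<a+c = +-cancelʳ-≤ a
      (≤-resp-≈ (sym (-‿inverseˡ a)) (+-comm a c) (<⇒≤ 0<a+c))

    shift : ∀ {a b} → - a ≤ b → 0# ≤ a + b
    shift {a} {b} -a≤b = ≤-resp-≈ (-‿inverseʳ a) refl (+-monoʳ-≤ a -a≤b)

  -- The size is the supremum of all coordinate differences within `S`. A coordinate must exist for
  -- this set to be inhabited: in dimension 0 every `r` encloses `S`, and there is no least one.
  size : 1 ℕ.≤ d → ∀ {S} → IsObject S → ∃[ s ] IsSize S s
  size (s≤s _) {S} object = s , cube , minimal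
    where
    open IsObject object

    origin : Fin d
    origin = zero

    above : ∀ i → ∃[ b ] (∀ {x} → x ∈ S → x i ≤ b)
    above = compact⇒above compact

    below : ∀ i → ∃[ b ] (∀ {x} → x ∈ S → 0# ≤ x i + b)
    below = compact⇒below compact

    bound : ∃[ b ] (∀ i → proj₁ (above i) + proj₁ (below i) ≤ b)
    bound = finite-upperBound λ i → proj₁ (above i) + proj₁ (below i)

    Extent : Pred Carrier 0ℓ
    Extent e = ∃[ i ] ∃[ y ] ∃[ z ] y ∈ S × z ∈ S × z i + e ≈ y i

    extent≤bound : ∀ e → e ∈ Extent → e ≤ proj₁ bound
    extent≤bound e (i , y , z , y∈S , z∈S , z+e≈y) = ≤R.begin
      e                                 ≤R.≈⟨ +-identityˡ e ⟨
      0# + e                            ≤R.≤⟨ +-monoˡ-≤ e (proj₂ (below i) z∈S) ⟩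
      (z i + proj₁ (below i)) + e       ≤R.≈⟨ solve 3 (λ z b e → (z :+ b) :+ e := (z :+ e) :+ b) refl
                                                (z i) (proj₁ (below i)) e ⟩
      (z i + e) + proj₁ (below i)       ≤R.≈⟨ +-congʳ z+e≈y ⟩
      y i + proj₁ (below i)             ≤R.≤⟨ +-monoˡ-≤ _ (proj₂ (above i) y∈S) ⟩
      proj₁ (above i) + proj₁ (below i) ≤R.≤⟨ proj₂ bound i ⟩
      proj₁ bound                       ≤R.∎

    sup : ∃[ s ] (∀ e → e ∈ Extent → e ≤ s) × (∀ b → (∀ e → e ∈ Extent → e ≤ b) → s ≤ b)
    sup = supremum Extent
      (0# , origin , proj₁ nonempty , proj₁ nonempty , proj₂ nonempty , proj₂ nonempty , +-identityʳ _)
      (proj₁ bound , extent≤bound)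

    s : Carrier
    s = proj₁ sup

    z+[y-z]≈y : ∀ y z → z + (y - z) ≈ y
    z+[y-z]≈y y z = trans (+-comm z _) (minus-+ y z)

    cube : ∃[ a ] S ⊆ Cube a s
    cube = diameter⇒cube nonempty λ {y} {z} y∈S z∈S i →
      ≤-respˡ-≈ (z+[y-z]≈y (y i) (z i))
        (+-monoʳ-≤ (z i) (proj₁ (proj₂ sup) _ (i , y , z , y∈S , z∈S , z+[y-z]≈y (y i) (z i))))

    minimal : ∀ a r → S ⊆ Cube a r → s ≤ r
    minimal a r S⊆C = proj₂ (proj₂ sup) r λ { e (i , y , z , y∈S , z∈S , z+e≈y) →
      +-cancelʳ-≤ (z i) (≤-resp-≈ (trans (sym z+e≈y) (+-comm (z i) e)) (+-comm (z i) r)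
        (cube⇒diameter S⊆C y∈S z∈S i)) }

  -- Each member is charged to the first listed cube that it meets. Fatness at scale `s` lets a cube
  -- be charged at most `c` times.
  count-by-cubes : ∀ {n c s} {O : Family n} → IsFat c O → ∀ ps us →
    AllPairs (λ u v → ¬ Intersects (O u) (O v)) us →
    All (λ u → SizeAtLeast s (O u)) us →
    All (λ u → Any (λ p → Intersects (O u) (Cube p s)) ps) us →
    fromℕ (length us) ≤ length ps ⋆ c
  count-by-cubes fat []       []       disjoint large hit = ≤-refl
  count-by-cubes fat []       (u ∷ us) disjoint large (() ∷ _)
  count-by-cubes {n} {c} {s} {O} fat (p ∷ ps) us disjoint large hit = ≤R.begin
    fromℕ (length us)                         ≤R.≈⟨ ×-congˡ (length-filter-complement hits? us) ⟩
    fromℕ (length us₁ ℕ.+ length us₂)         ≤R.≈⟨ ×-homo-+ 1# (length us₁) (length us₂) ⟩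
    fromℕ (length us₁) + fromℕ (length us₂)   ≤R.≤⟨ +-mono-≤ us₁≤ us₂≤ ⟩
    c + length ps ⋆ c                         ≤R.∎
    where
    hits? : Decidable (λ u → Intersects (O u) (Cube p s))
    hits? u = lem

    us₁ us₂ : List (Fin n)
    us₁ = filter hits? us
    us₂ = filter (¬? ∘ hits?) us

    us₁≤ : fromℕ (length us₁) ≤ c
    us₁≤ = fat s p us₁ (AllPairsₚ.filter⁺ hits? disjoint)
      (All.zip (Allₚ.filter⁺ hits? large , Allₚ.all-filter hits? us))

    later : ∀ {u} → ¬ Intersects (O u) (Cube p s) × Any (λ q → Intersects (O u) (Cube q s)) (p ∷ ps) →
            Any (λ q → Intersects (O u) (Cube q s)) ps
    later (¬hit , here hit)  = ⊥-elim (¬hit hit)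
    later (¬hit , there hit) = hit

    us₂≤ : fromℕ (length us₂) ≤ length ps ⋆ c
    us₂≤ = count-by-cubes fat ps us₂
      (AllPairsₚ.filter⁺ (¬? ∘ hits?) disjoint)
      (Allₚ.filter⁺ (¬? ∘ hits?) large)
      (All.map later (All.zip (Allₚ.all-filter (¬? ∘ hits?) us , Allₚ.filter⁺ (¬? ∘ hits?) hit)))

-- The unions over balls form a fat representation of the power

*-^-distrib : ∀ l m d → (l ℕ.* m) ℕ.^ d ≡ l ℕ.^ d ℕ.* m ℕ.^ d
*-^-distrib l m zero    = ≡.refl
*-^-distrib l m (suc d) = ≡.trans (≡.cong (l ℕ.* m ℕ.*_) (*-^-distrib l m d))
  (solve 4 (λ l m x y → (l :* m) :* (x :* y) := (l :* x) :* (m :* y)) ≡.refl l m (l ℕ.^ d) (m ℕ.^ d))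
  where open +-*-Solver

2k+1≡k+[1+k] : ∀ k → 2 ℕ.* k ℕ.+ 1 ≡ k ℕ.+ (1 ℕ.+ k)
2k+1≡k+[1+k] = solve 1 (λ k → con 2 :* k :+ con 1 := k :+ (con 1 :+ k)) ≡.refl
  where open +-*-Solver

module BallUnions (lem : ExcludedMiddle 0ℓ) (ℝ : CompleteOrderedField) (d : ℕ) (1≤d : 1 ℕ.≤ d)
                  {n : ℕ} (G : Graph n) (O : Euclidean.Family ℝ d n) where
  open OrderedField lem ℝ
  open Euclidean ℝ d
  open Paths lem ℝ d
  open Grid lem ℝ
  open Sizes lem ℝ d
  open Walks lem G

  axis : Fin d
  axis = fromℕ< 1≤d

  BallUnion : ℕ → Family n
  BallUnion k v x = ∃[ u ] u ∈ Ball k v × x ∈ O u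

  -- `O′` is fixed only up to mutual inclusion, because the memory of the machine holds iterated
  -- binary unions rather than the predicate `BallUnion` itself.
  module _ {c : Carrier} (representation : IsFatRepresentation G c O) (k : ℕ)
           (O′ : Family n) (O′≐ : ∀ v → O′ v ≐ BallUnion k v) where
    open IsFatRepresentation representation
    open IsObject

    to : ∀ {v x} → x ∈ O′ v → x ∈ BallUnion k v
    to = proj₁ (O′≐ _)

    from : ∀ {v x} → x ∈ BallUnion k v → x ∈ O′ v
    from = proj₂ (O′≐ _)

    adj⇒intersects : ∀ {u v} → Graph.Adj G u v → Intersects (O u) (O v)
    adj⇒intersects {u} {v} = proj₂ ∘ Equivalence.to (intersectionGraph u v)

    intersects⇒ball : ∀ {u v} → Intersects (O u) (O v) → v ∈ Ball 1 u
    intersects⇒ball {u} {v} meet with u Finₚ.≟ v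
    ... | yes ≡.refl = ball-centre 1 u
    ... | no  u≢v    = ball-cons (Equivalence.from (intersectionGraph u v) (u≢v , meet)) (ball-centre 0 v)

    O′-respects : ∀ v {x y} → (∀ i → x i ≈ y i) → x ∈ O′ v → y ∈ O′ v
    O′-respects v x≈y x∈ with to x∈
    ... | u , u∈B , x∈u = from (u , u∈B , respects (objects u) x≈y x∈u)

    -- Each edge of the walk supplies a common point of two consecutive objects, where the path
    -- passes from one to the next. A walk inside the ball keeps the path in the union.
    O′-joined : ∀ v {u w m x y} → u ∈ Ball k v → Walk (induced (Ball k v)) u w m →
                x ∈ O u → y ∈ O w → Joined (O′ v) x y
    O′-joined v {u} {x = x} {y} u∈B nil x∈ y∈ =
      joined-mono {S = O u} {T = O′ v} (λ z∈ → from (u , u∈B , z∈))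
        (pathConnected (objects u) x y x∈ y∈)
    O′-joined v u∈B (cons (e , _ , b∈B) p) x∈ y∈ with adj⇒intersects e
    ... | z , z∈u , z∈b = joined-trans (O′-respects v)
      (O′-joined v u∈B nil x∈ z∈u) (O′-joined v b∈B p z∈b y∈)

    O′-pathConnected : ∀ v → IsPathConnected (O′ v)
    O′-pathConnected v x y x∈ y∈ with to x∈ | to y∈
    ... | u , u∈B , x∈u | w , w∈B , y∈w =
      O′-joined v u∈B (proj₂ (proj₂ (ball-connected u∈B w∈B))) x∈u y∈w

    O′-compact : ∀ v → IsCompact (O′ v)
    O′-compact v I U opens covers with subcover (allFin n)
      where
      subcover : ∀ us → ∃[ is ]
        (∀ {u x} → Any (u ≡_) us → u ∈ Ball k v → x ∈ O u → Any (λ i → x ∈ U i) is)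
      subcover []       = [] , λ ()
      subcover (u ∷ us) with subcover us | lem {u ∈ Ball k v}
      ... | is , cov | no u∉B = is , λ where
        (here ≡.refl) u∈B → ⊥-elim (u∉B u∈B)
        (there u∈us)      → cov u∈us
      ... | is , cov | yes u∈B
        with compact (objects u) I U opens (λ x x∈u → covers x (from (u , u∈B , x∈u)))
      ...   | js , cov′ = js ++ is , λ where
        (here ≡.refl) _   x∈ → Anyₚ.++⁺ˡ (cov′ _ x∈)
        (there u∈us)  u∈B x∈ → Anyₚ.++⁺ʳ js (cov u∈us u∈B x∈)
    ... | is , cov = is , λ x x∈ → let (u , u∈B , x∈u) = to x∈ in cov (∈-allFin u) u∈B x∈u

    O′-object : ∀ v → IsObject (O′ v)
    O′-object v = record
      { respects      = O′-respects v
      ; nonempty      = let (x , x∈) = nonempty (objects v) in x , from (v , ball-centre k v , x∈)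
      ; pathConnected = O′-pathConnected v
      ; compact       = O′-compact v
      }

    O′-intersectionGraph : IsIntersectionGraph (power G (2 ℕ.* k ℕ.+ 1)) O′
    O′-intersectionGraph u v = mk⇔
      (λ { (u≢v , m , (p , _) , m≤) →
           u≢v , meets (m , p , ℕₚ.≤-trans m≤ (ℕₚ.≤-reflexive (2k+1≡k+[1+k] k))) })
      (λ { (u≢v , x , x∈u , x∈v) → ball⇒power-adj u≢v (near (to x∈u) (to x∈v)) })
      where
      -- The walk is cut into pieces of at most `k`, 1 and `k` edges. If the middle piece is empty,
      -- one object belongs to both unions and its nonemptiness gives the point; otherwise the edge
      -- does.
      meets : v ∈ Ball (k ℕ.+ (1 ℕ.+ k)) u → Intersects (O′ u) (O′ v)
      meets v∈B with ball-split k v∈B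
      ... | u′ , u′∈B , v∈B′ with ball-split 1 v∈B′
      ...   | _  , (_ , nil        , _) , v∈B″ =
        let (x , x∈) = nonempty (objects u′)
        in  x , from (u′ , u′∈B , x∈) , from (u′ , ball-sym v∈B″ , x∈)
      ...   | v′ , (_ , cons e nil , _) , v∈B″ =
        let (x , x∈u′ , x∈v′) = adj⇒intersects e
        in  x , from (u′ , u′∈B , x∈u′) , from (v′ , ball-sym v∈B″ , x∈v′)
      ...   | _  , (_ , cons _ (cons _ _) , s≤s ()) , _

      near : ∀ {x} → x ∈ BallUnion k u → x ∈ BallUnion k v → v ∈ Ball (2 ℕ.* k ℕ.+ 1) u
      near (u′ , u′∈B , x∈u′) (v′ , v′∈B , x∈v′) =
        ball-mono (ℕₚ.≤-reflexive (≡.sym (2k+1≡k+[1+k] k)))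
          (ball-trans u′∈B (ball-trans (intersects⇒ball (_ , x∈u′ , x∈v′)) (ball-sym v′∈B)))

    Close : Carrier → Point → Region
    Close e x y = ∀ i → x i ≤ y i + e × y i ≤ x i + e

    close-mono : ∀ {e f x} → e ≤ f → Close e x ⊆ Close f x
    close-mono {x = x} e≤f {y} close i =
      ≤-trans (proj₁ (close i)) (+-monoʳ-≤ (y i) e≤f) ,
      ≤-trans (proj₂ (close i)) (+-monoʳ-≤ (x i) e≤f)

    -- Crossing one object of diameter at most `t` takes closeness from `j ⋆ t` to `suc j ⋆ t`.
    -- Smallness is assumed only for objects meeting the `N ⋆ t` neighbourhood of `x`; `j + m < N`
    -- keeps every entry point within it, and counts the `m + 1` objects still to be crossed.
    spread : ∀ v N {t x} → 0# ≤ t →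
             (∀ {a y} → a ∈ Ball k v → y ∈ O a → Close (N ⋆ t) x y → Diameter≤ (O a) t) →
             ∀ {u w m} → u ∈ Ball k v → Walk (induced (Ball k v)) u w m → ∀ j → j ℕ.+ m ℕ.< N →
             ∀ {y} → y ∈ O u → Close (j ⋆ t) x y → O w ⊆ Close (N ⋆ t) x
    spread v N {t} {x} 0≤t small = go
      where
      extend : ∀ {u} j → j ℕ.< N → u ∈ Ball k v →
               ∀ {y} → y ∈ O u → Close (j ⋆ t) x y → O u ⊆ Close (suc j ⋆ t) x
      extend {u} j j<N u∈B {y} y∈u close {z} z∈u i =
        ≤-trans (proj₁ (close i)) (≤-respʳ-≈ (+-assoc (z i) t _) (+-monoˡ-≤ _ (diam y∈u z∈u i))) ,
        ≤-trans (diam z∈u y∈u i) (≤-respʳ-≈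
          (solve 3 (λ x s t → (x :+ s) :+ t := x :+ (t :+ s)) refl (x i) (j ⋆ t) t)
          (+-monoˡ-≤ t (proj₂ (close i))))
        where
        diam : Diameter≤ (O u) t
        diam = small u∈B y∈u (close-mono (⋆-monoˡ-≤ 0≤t (ℕₚ.<⇒≤ j<N)) close)

      go : ∀ {u w m} → u ∈ Ball k v → Walk (induced (Ball k v)) u w m → ∀ j → j ℕ.+ m ℕ.< N →
           ∀ {y} → y ∈ O u → Close (j ⋆ t) x y → O w ⊆ Close (N ⋆ t) x
      go u∈B nil j j+m<N y∈u close z∈u =
        close-mono (⋆-monoˡ-≤ 0≤t j<N) (extend j j<N u∈B y∈u close z∈u)
        where
        j<N : j ℕ.< N
        j<N = ≡.subst (ℕ._< N) (ℕₚ.+-identityʳ j) j+m<N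
      go {m = suc m} u∈B (cons (e , _ , b∈B) p) j j+m<N y∈u close with adj⇒intersects e
      ... | z , z∈u , z∈b = go b∈B p (suc j) (≡.subst (ℕ._< N) (ℕₚ.+-suc j m) j+m<N) z∈b
        (extend j (ℕₚ.≤-<-trans (ℕₚ.m≤m+n j _) j+m<N) u∈B y∈u close z∈u)

    -- A union of diameter at least r that is reached from x by chains of at most 2k+1 objects of
    -- diameter at most t < r/(2k+1) cannot exist; the chains never leave the r-neighbourhood of x,
    -- so only objects meeting that neighbourhood matter.
    large-member : ∀ v {r s S x} → suc (2 ℕ.* k) ⋆ s ≈ r → IsSize (O′ v) S → r ≤ S → x ∈ O′ v →
                   0# ≤ r → ∃[ u ] u ∈ Ball k v × SizeAtLeast s (O u) × Intersects (O u) (Close r x)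
    large-member v {r} {s} {S} {x} Ns≈r isSize r≤S x∈ 0≤r
      with lem {∃[ u ] u ∈ Ball k v × s ≤ proj₁ (size 1≤d (objects u)) × Intersects (O u) (Close r x)}
    ... | yes (u , u∈B , s≤ , meet) =
      u , u∈B , (proj₁ (size 1≤d (objects u)) , proj₂ (size 1≤d (objects u)) , s≤) , meet
    ... | no ∄u with finite-strictBound
                       (λ u → u ∈ Ball k v × Intersects (O u) (Close r x))
                       (λ u → proj₁ (size 1≤d (objects u))) s
                       (λ u (u∈B , meet) → [ (λ s≤ → ⊥-elim (∄u (u , u∈B , s≤ , meet))) , (λ < → <) ]′
                                             (≤⊎> s (proj₁ (size 1≤d (objects u)))))
    ...   | t , t<s , ≤t = ⊥-elim (<-irrefl (≤-<-trans r≤S (≤-<-trans S≤Nt Nt<r)))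
      where
      N : ℕ
      N = suc (2 ℕ.* k)

      Nt<r : N ⋆ t < r
      Nt<r = <-resp-≈ refl Ns≈r (⋆-monoʳ-< (2 ℕ.* k) t<s)

      small : ∀ {a y} → a ∈ Ball k v → y ∈ O a → Close r x y → Diameter≤ (O a) t
      small {a} {y} a∈B y∈a close z∈a w∈a i = ≤-trans
        (cube⇒diameter (proj₂ (proj₁ (proj₂ (size 1≤d (objects a))))) z∈a w∈a i)
        (+-monoʳ-≤ _ (≤t a (a∈B , y , y∈a , close)))

      close-self : ∀ {e} → 0# ≤ e → ∀ y → Close e y y
      close-self 0≤e y i = y≤y+e , y≤y+e
        where
        y≤y+e : y i ≤ y i + _
        y≤y+e = ≤-respˡ-≈ (+-identityʳ (y i)) (+-monoʳ-≤ (y i) 0≤e)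

      -- `t` comes only with an upper bound. The object through `x` has diameter at most `t`, which
      -- excludes a negative `t`; the monotonicity of `j ⋆ t` in `j` depends on this.
      0≤t : 0# ≤ t
      0≤t with to x∈
      ... | u , u∈B , x∈u = +-cancelʳ-≤ (x axis)
        (≤-resp-≈ (sym (+-identityˡ (x axis))) (+-comm (x axis) t)
          (small u∈B x∈u (close-self 0≤r x) x∈u x∈u axis))

      reach : ∀ {x′} → x′ ∈ O′ v →
              (∀ {a y} → a ∈ Ball k v → y ∈ O a → Close (N ⋆ t) x′ y → Diameter≤ (O a) t) →
              O′ v ⊆ Close (N ⋆ t) x′
      reach {x′} x′∈ small y∈ with to x′∈ | to y∈
      ... | u , u∈B , x′∈u | w , w∈B , y∈w with ball-connected u∈B w∈B
      ...   | m , m≤k+k , p = spread v N 0≤t small u∈B p 0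
        (s≤s (ℕₚ.≤-trans m≤k+k (ℕₚ.≤-reflexive (≡.cong (k ℕ.+_) (≡.sym (ℕₚ.+-identityʳ k))))))
        x′∈u (close-self ≤-refl x′) y∈w

      -- First pass, starting at `x`: afterwards every member of the ball is known to meet the
      -- `r`-neighbourhood of `x`, so `small` applies to all of them.
      everything-close : O′ v ⊆ Close r x
      everything-close y∈ = close-mono (<⇒≤ Nt<r)
        (reach x∈ (λ a∈B y∈a close → small a∈B y∈a (close-mono (<⇒≤ Nt<r) close)) y∈)

      S≤Nt : S ≤ N ⋆ t
      -- Second pass, starting at an arbitrary `y`. The first pass alone would bound the diameter
      -- only by twice `N ⋆ t`.
      S≤Nt = size≤ (x , x∈) isSize λ y∈ z∈ i → proj₁
        (reach y∈ (λ a∈B w∈a _ → small a∈B w∈a (everything-close (from (_ , a∈B , w∈a)))) z∈ i)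

    module _ {r : Carrier} {a : Point} where
      Hit : Pred (Fin n) 0ℓ
      Hit v = SizeAtLeast r (O′ v) × Intersects (O′ v) (Cube a r)

      s : Carrier
      s = proj₁ (divide (2 ℕ.* k) r)

      Ns≈r : suc (2 ℕ.* k) ⋆ s ≈ r
      Ns≈r = proj₂ (divide (2 ℕ.* k) r)

      corner : Point
      corner i = a i - r

      cubes : List Point
      cubes = grid (3 ℕ.* suc (2 ℕ.* k)) corner s

      HitsGrid : Pred (Fin n) 0ℓ
      HitsGrid u = SizeAtLeast s (O u) × Any (λ p → Intersects (O u) (Cube p s)) cubes

      cubes-cover : ∀ {x y} → x ∈ Cube a r → y ∈ Close r x → Any (λ p → y ∈ Cube p s) cubes
      cubes-cover {x} {y} x∈C close = grid-cover _ corner s y λ i →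
        +-cancelʳ-≤ r (≤-respˡ-≈ (sym (minus-+ (a i) r))
          (≤-trans (proj₁ (x∈C i)) (proj₁ (close i)))) ,
        (≤R.begin
          y i                                          ≤R.≤⟨ proj₂ (close i) ⟩
          x i + r                                      ≤R.≤⟨ +-monoˡ-≤ r (proj₂ (x∈C i)) ⟩
          (a i + r) + r                                ≤R.≈⟨ +-congʳ (+-congʳ (minus-+ (a i) r)) ⟨
          ((corner i + r) + r) + r                     ≤R.≈⟨ solve 2 (λ c r →
            ((c :+ r) :+ r) :+ r := c :+ (r :+ (r :+ (r :+ con 0)))) refl (corner i) r ⟩
          corner i + 3 ⋆ r                             ≤R.≈⟨ +-congˡ (×-congʳ 3 Ns≈r) ⟨
          corner i + 3 ⋆ (suc (2 ℕ.* k) ⋆ s)           ≤R.≈⟨ +-congˡ (×-assocˡ s 3 (suc (2 ℕ.* k))) ⟩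
          corner i + (3 ℕ.* suc (2 ℕ.* k)) ⋆ s         ≤R.∎)

      cube-nonNeg : ∀ {x} → x ∈ Cube a r → 0# ≤ r
      cube-nonNeg {x} x∈C = +-cancelʳ-≤ (a axis) (≤-resp-≈ (sym (+-identityˡ (a axis))) (+-comm (a axis) r)
        (≤-trans (proj₁ (x∈C axis)) (proj₂ (x∈C axis))))

      -- The condition `Hit v` guards only the last component, so that the choice is a total
      -- function that can be mapped over a list, with `v` itself as default. Membership in the ball
      -- is unconditional and carries disjointness over to the chosen objects.
      member : ∀ v → ∃[ u ] u ∈ Ball k v × (Hit v → HitsGrid u)
      member v with lem {Hit v}
      ... | no  miss = v , ball-centre k v , ⊥-elim ∘ miss
      ... | yes ((S , isSize , r≤S) , x , x∈ , x∈C)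
        with large-member v Ns≈r isSize r≤S x∈ (cube-nonNeg x∈C)
      ...   | u , u∈B , large , y , y∈u , close = u , u∈B , λ _ →
        large , Any.map (λ y∈C → y , y∈u , y∈C) (cubes-cover x∈C close)

      fewHits : ∀ vs → AllPairs (λ u v → ¬ Intersects (O′ u) (O′ v)) vs → All Hit vs →
                fromℕ (length vs) ≤ fromℕ (3 ℕ.^ d ℕ.* (2 ℕ.* k ℕ.+ 1) ℕ.^ d) * c
      fewHits vs disjoint hits = ≤R.begin
        fromℕ (length vs)   ≤R.≈⟨ ×-congˡ (≡.sym (length-map f vs)) ⟩
        fromℕ (length us)   ≤R.≤⟨ count-by-cubes fat cubes us disjoint′
                                    (All.map proj₁ hits′) (All.map proj₂ hits′) ⟩
        length cubes ⋆ c    ≤R.≈⟨ ×-congˡ length-cubes ⟩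
        (3 ℕ.^ d ℕ.* (2 ℕ.* k ℕ.+ 1) ℕ.^ d) ⋆ c  ≤R.≈⟨ ⋆≈fromℕ* (3 ℕ.^ d ℕ.* (2 ℕ.* k ℕ.+ 1) ℕ.^ d) c ⟩
        fromℕ (3 ℕ.^ d ℕ.* (2 ℕ.* k ℕ.+ 1) ℕ.^ d) * c ≤R.∎
        where
        f : Fin n → Fin n
        f v = proj₁ (member v)

        us : List (Fin n)
        us = map f vs

        O∘f⊆O′ : ∀ v → O (f v) ⊆ O′ v
        O∘f⊆O′ v x∈ = from (f v , proj₁ (proj₂ (member v)) , x∈)

        disjoint′ : AllPairs (λ u v → ¬ Intersects (O u) (O v)) us
        disjoint′ = AllPairsₚ.map⁺ (AllPairs.map
          (λ {u} {v} ¬meet (x , x∈u , x∈v) → ¬meet (x , O∘f⊆O′ u x∈u , O∘f⊆O′ v x∈v)) disjoint)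

        hits′ : All HitsGrid us
        hits′ = Allₚ.map⁺ (All.map (λ {v} → proj₂ (proj₂ (member v))) hits)

        length-cubes : length cubes ≡ 3 ℕ.^ d ℕ.* (2 ℕ.* k ℕ.+ 1) ℕ.^ d
        length-cubes = ≡.trans (length-grid (3 ℕ.* suc (2 ℕ.* k)) corner s)
          (≡.trans (*-^-distrib 3 (suc (2 ℕ.* k)) d)
            (≡.cong (λ m → 3 ℕ.^ d ℕ.* m ℕ.^ d) (ℕₚ.+-comm 1 (2 ℕ.* k))))

    O′-representation : IsFatRepresentation (power G (2 ℕ.* k ℕ.+ 1))
                          (fromℕ (3 ℕ.^ d ℕ.* (2 ℕ.* k ℕ.+ 1) ℕ.^ d) * c) O′
    O′-representation = record
      { objects           = O′-object
      ; intersectionGraph = O′-intersectionGraph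
      ; fat               = λ r a → fewHits
      }

-- Registers: 0: n, 2: 1, 3: remaining rounds, 4: v, 5: u, 6: n + v, 7: 2n + v,
-- 8: adjacency flag, 9: n + u, 10: 2n, 11: 0. The current union of v is Ω[n + v], and the next
-- one is accumulated in Ω[2n + v]. Since a shortest walk has length below n, min(k, n)
-- = n ∸ (n ∸ k) rounds suffice, which makes the running time independent of k.

forEach : ℕ → Program → Program
forEach x P = instr (sub x 0 11) ⨾ while x (instr (sub x x 2) ⨾ P)

initialise collect commit rounds ballUnionProgram : Program
initialise = forEach 4
  (instr (add 6 0 4) ⨾ instr (add 7 10 4) ⨾ instr (copyObj 6 4) ⨾ instr (copyObj 7 4))
collect = forEach 4 (instr (add 7 10 4) ⨾ forEach 5
  (instr (add 9 0 5) ⨾ instr (adjacent 8 4 5) ⨾ ifnz 8 (instr (unionObj 7 7 9)) skip))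
commit = forEach 4 (instr (add 6 0 4) ⨾ instr (add 7 10 4) ⨾ instr (copyObj 6 7))
rounds = while 3 (instr (sub 3 3 2) ⨾ collect ⨾ commit)
ballUnionProgram =
  instr (const 2 1) ⨾ instr (add 10 0 0) ⨾ instr (sub 3 0 1) ⨾ instr (sub 3 0 3) ⨾
  initialise ⨾ rounds

-- Correctness and running time of the program

module Correctness (lem : ExcludedMiddle 0ℓ) (ℝ : CompleteOrderedField) (d : ℕ) (1≤d : 1 ℕ.≤ d)
                   {n : ℕ} (G : Graph n) (O : Euclidean.Family ℝ d n) where
  open Euclidean ℝ d using (Region)
  open Machine lem ℝ d
  open State
  open Walks lem G
  open BallUnions lem ℝ d 1≤d G O using (BallUnion)

  ≐-trans : {S S′ S″ : Region} → S ≐ S′ → S′ ≐ S″ → S ≐ S″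
  ≐-trans (f , g) (f′ , g′) = (λ x∈ → f′ (f x∈)) , (λ x∈ → g (g′ x∈))

  -- A Hoare triple for total correctness with a time budget. `T` is only an upper bound, so the two
  -- branches of a conditional may share it.
  Halts : Program → State → ℕ → (State → Set) → Set₁
  Halts P σ T Q = ∃[ t ] ∃[ σ′ ] Run G P σ t σ′ × t ℕ.≤ T × Q σ′

  weaken : ∀ {P σ S T Q R} → S ℕ.≤ T → (∀ {τ} → Q τ → R τ) → Halts P σ S Q → Halts P σ T R
  weaken S≤T Q⇒R (t , τ , run , t≤S , q) = t , τ , run , ℕₚ.≤-trans t≤S S≤T , Q⇒R q

  infixr 5 _then_ _step_

  _then_ : ∀ {P P′ σ S T Q R} → Halts P σ S Q → (∀ {τ} → Q τ → Halts P′ τ T R) →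
           Halts (P ⨾ P′) σ (S ℕ.+ T) R
  (s , τ , run , s≤S , q) then next with next q
  ... | t , υ , run′ , t≤T , r = s ℕ.+ t , υ , seq run run′ , ℕₚ.+-mono-≤ s≤S t≤T , r

  _step_ : ∀ i {P σ T Q} → Halts P (exec G i σ) T Q → Halts (instr i ⨾ P) σ (suc T) Q
  i step (t , τ , run , t≤T , q) = suc t , τ , seq instr run , s≤s t≤T , q

  final : ∀ i {σ Q} → Q (exec G i σ) → Halts (instr i) σ 1 Q
  final i q = 1 , _ , instr , ℕₚ.≤-refl , q

  -- The invariant is indexed by the counter. The test before each iteration accounts for `suc T`,
  -- the final failing test for the `+ 1`.
  loop : ∀ x {P T} (Inv : ℕ → State → Set) → (∀ {j σ} → Inv j σ → reg σ x ≡ j) →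
         (∀ {j σ} → Inv (suc j) σ → Halts P σ T (Inv j)) →
         ∀ j {σ} → Inv j σ → Halts (while x P) σ (j ℕ.* suc T ℕ.+ 1) (Inv 0)
  loop x Inv counter body zero    inv = 1 , _ , while-exit (counter inv) , ℕₚ.≤-refl , inv
  loop x {T = T} Inv counter body (suc j) inv with body inv
  ... | s , τ , run , s≤T , inv′ with loop x Inv counter body j inv′
  ...   | t , υ , run′ , t≤ , done =
    suc (s ℕ.+ t) , υ ,
    while-loop (λ x≡0 → ℕₚ.0≢1+n (≡.trans (≡.sym x≡0) (counter inv))) run run′ ,
    s≤s (ℕₚ.≤-trans (ℕₚ.+-mono-≤ s≤T t≤) (ℕₚ.≤-reflexive (≡.sym (ℕₚ.+-assoc T _ 1)))) ,
    done

  truth≢0⇒ : ∀ {P : Set} → truth P ≢ 0 → P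
  truth≢0⇒ {P} ≢0 with lem {P}
  ... | yes p = p
  ... | no  _ = ⊥-elim (≢0 ≡.refl)

  truth≡0⇒ : ∀ {P : Set} → truth P ≡ 0 → ¬ P
  truth≡0⇒ {P} ≡0 with lem {P}
  ... | yes _ = ⊥-elim (ℕₚ.1+n≢0 ≡0)
  ... | no ¬p = ¬p

  update-≐ : ∀ (Ω : ℕ → Region) {S Z : Region} a e → (a ≡ e → S ≐ Z) → (a ≢ e → Ω e ≐ Z) →
             (Ω [ a ↦ S ]) e ≐ Z
  update-≐ Ω a e same other with a ℕ.≡ᵇ e in eq
  ... | true  = same (ℕₚ.≡ᵇ⇒≡ a e (≡.subst T (≡.sym eq) tt))
  ... | false = other λ a≡e → ≡.subst T eq (ℕₚ.≡⇒≡ᵇ a e a≡e)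

  -- Vertices are named by numbers, as on the machine.
  Unions : ℕ → ℕ → Region
  Unions j a x = ∃[ v ] toℕ v ≡ a × x ∈ BallUnion j v

  -- This is the proposition that the instruction `adjacent` tests, so the flag it leaves can be
  -- read back without translation.
  Adjacent : ℕ → ℕ → Set
  Adjacent a b = ∃[ u ] ∃[ v ] toℕ u ≡ a × toℕ v ≡ b × Graph.Adj G u v

  unions-mono : ∀ {j a} → Unions j a ⊆ Unions (suc j) a
  unions-mono (v , v≡a , u , u∈B , x∈u) = v , v≡a , u , ball-mono (ℕₚ.n≤1+n _) u∈B , x∈u

  unions-cons : ∀ {j a b} → Adjacent a b → Unions j b ⊆ Unions (suc j) a
  unions-cons {j} (v , w , v≡a , w≡b , e) (w′ , w′≡b , u , u∈B , x∈u) =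
    v , v≡a , u , ball-cons (≡.subst (Graph.Adj G v) w≡w′ e) u∈B , x∈u
    where
    w≡w′ : w ≡ w′
    w≡w′ = Finₚ.toℕ-injective (≡.trans w≡b (≡.sym w′≡b))

  unions-uncons : ∀ {j a x} → x ∈ Unions (suc j) a →
                  x ∈ Unions j a ⊎ (∃[ b ] Adjacent a b × x ∈ Unions j b)
  unions-uncons (v , v≡a , u , u∈B , x∈u) with ball-uncons u∈B
  ... | inj₁ u∈B′           = inj₁ (v , v≡a , u , u∈B′ , x∈u)
  ... | inj₂ (w , e , u∈B′) =
    inj₂ (toℕ w , (v , w , v≡a , ≡.refl , e) , w , ≡.refl , u , u∈B′ , x∈u)

  Layout : (A B : ℕ → Region) → (ℕ → Region) → Set
  Layout A B Ω = ∀ b → b ℕ.< n →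
    Ω b ≐ Unions 0 b × Ω (n ℕ.+ b) ≐ A b × Ω (n ℕ.+ n ℕ.+ b) ≐ B b

  layout-resp : ∀ {A A′ B B′ Ω} → (∀ {b} → b ℕ.< n → A b ≐ A′ b) → (∀ {b} → b ℕ.< n → B b ≐ B′ b) →
                Layout A B Ω → Layout A′ B′ Ω
  layout-resp A≐A′ B≐B′ layout b b<n with layout b b<n
  ... | Ω₀ , Ω₁ , Ω₂ = Ω₀ , ≐-trans Ω₁ (A≐A′ b<n) , ≐-trans Ω₂ (B≐B′ b<n)

  private
    n+a≢b : ∀ {a b} → b ℕ.< n → n ℕ.+ a ≢ b
    n+a≢b b<n ≡.refl = ℕₚ.<⇒≱ b<n (ℕₚ.m≤m+n n _)

    2n+a≢n+b : ∀ {a b} → b ℕ.< n → n ℕ.+ n ℕ.+ a ≢ n ℕ.+ b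
    2n+a≢n+b {a} b<n eq = n+a≢b b<n (ℕₚ.+-cancelˡ-≡ n _ _ (≡.trans (≡.sym (ℕₚ.+-assoc n n a)) eq))

    2n+a≢b : ∀ {a b} → b ℕ.< n → n ℕ.+ n ℕ.+ a ≢ b
    2n+a≢b {a} b<n eq = n+a≢b b<n (≡.trans (≡.sym (ℕₚ.+-assoc n n a)) eq)

  -- The bound `a < n` keeps the cell `n + a` out of the third block. In `write₂` the cell belongs
  -- to the last block, with nothing above it to protect.
  write₁ : ∀ {A A′ B Ω S r a} → r ≡ n ℕ.+ a → a ℕ.< n → S ≐ A′ a →
           (∀ {b} → a ≢ b → A b ≐ A′ b) → Layout A B Ω → Layout A′ B (Ω [ r ↦ S ])
  write₁ {A′ = A′} {Ω = Ω} {S} {a = a} ≡.refl a<n S≐A′ A≐A′ layout b b<n with layout b b<n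
  ... | Ω₀ , Ω₁ , Ω₂ =
    update-≐ Ω (n ℕ.+ a) b (⊥-elim ∘ n+a≢b b<n) (λ _ → Ω₀) ,
    update-≐ Ω (n ℕ.+ a) (n ℕ.+ b)
      (λ eq → ≡.subst (λ e → S ≐ A′ e) (ℕₚ.+-cancelˡ-≡ n a b eq) S≐A′)
      (λ ≢ → ≐-trans Ω₁ (A≐A′ (≢ ∘ ≡.cong (n ℕ.+_)))) ,
    update-≐ Ω (n ℕ.+ a) (n ℕ.+ n ℕ.+ b) (⊥-elim ∘ 2n+a≢n+b a<n ∘ ≡.sym) (λ _ → Ω₂)

  write₂ : ∀ {A B B′ Ω S r a} → r ≡ n ℕ.+ n ℕ.+ a → S ≐ B′ a →
           (∀ {b} → a ≢ b → B b ≐ B′ b) → Layout A B Ω → Layout A B′ (Ω [ r ↦ S ])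
  write₂ {B′ = B′} {Ω = Ω} {S} {a = a} ≡.refl S≐B′ B≐B′ layout b b<n with layout b b<n
  ... | Ω₀ , Ω₁ , Ω₂ =
    update-≐ Ω (n ℕ.+ n ℕ.+ a) b (⊥-elim ∘ 2n+a≢b b<n) (λ _ → Ω₀) ,
    update-≐ Ω (n ℕ.+ n ℕ.+ a) (n ℕ.+ b) (⊥-elim ∘ 2n+a≢n+b b<n) (λ _ → Ω₁) ,
    update-≐ Ω (n ℕ.+ n ℕ.+ a) (n ℕ.+ n ℕ.+ b)
      (λ eq → ≡.subst (λ e → S ≐ B′ e) (ℕₚ.+-cancelˡ-≡ (n ℕ.+ n) a b eq) S≐B′)
      (λ ≢ → ≐-trans Ω₂ (B≐B′ (≢ ∘ ≡.cong (n ℕ.+ n ℕ.+_))))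

  -- A loop counting down from n to 0 has replaced X by X′ at the positions from c on; as X ⊆ X′, a
  -- union describes both the old and the new positions.
  Partial : (X X′ : ℕ → Region) → ℕ → ℕ → Region
  Partial X X′ c b x = x ∈ X b ⊎ (c ℕ.≤ b × x ∈ X′ b)

  partial-start : ∀ (X X′ : ℕ → Region) {b} → b ℕ.< n → X b ≐ Partial X X′ n b
  partial-start X X′ b<n = inj₁ , [ id , (λ (n≤b , _) → ⊥-elim (ℕₚ.<⇒≱ b<n n≤b)) ]′

  partial-end : ∀ (X X′ : ℕ → Region) {b} → X b ⊆ X′ b → Partial X X′ 0 b ≐ X′ b
  partial-end X X′ X⊆X′ = [ X⊆X′ , proj₂ ]′ , λ x∈ → inj₂ (z≤n , x∈)

  partial-here : ∀ (X X′ : ℕ → Region) {b} → X b ⊆ X′ b → X′ b ≐ Partial X X′ b b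
  partial-here X X′ X⊆X′ = (λ x∈ → inj₂ (ℕₚ.≤-refl , x∈)) , [ X⊆X′ , proj₂ ]′

  partial-step : ∀ (X X′ : ℕ → Region) {c b} → c ≢ b → Partial X X′ (suc c) b ≐ Partial X X′ c b
  partial-step X X′ c≢b =
    [ inj₁ , (λ (c<b , x∈) → inj₂ (ℕₚ.<⇒≤ c<b , x∈)) ]′ ,
    [ inj₁ , (λ (c≤b , x∈) → inj₂ (ℕₚ.≤∧≢⇒< c≤b c≢b , x∈)) ]′

  Constants : (ℕ → ℕ) → Set
  Constants R = R 0 ≡ n × R 2 ≡ 1 × R 10 ≡ n ℕ.+ n × R 11 ≡ 0

  Sweep : ℕ → (A B : ℕ → ℕ → Region) → ℕ → State → Set
  Sweep r A B c σ = Constants (reg σ) × reg σ 3 ≡ r × c ℕ.≤ n × reg σ 4 ≡ c × Layout (A c) (B c) (obj σ)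

  decrement : ∀ {x y j} → x ≡ suc j → y ≡ 1 → x ℕ.∸ y ≡ j
  decrement ≡.refl ≡.refl = ≡.refl

  reset : ∀ {x y} → x ≡ n → y ≡ 0 → x ℕ.∸ y ≡ n
  reset ≡.refl ≡.refl = ≡.refl

  -- The counter drops before the body runs, so on entry register 4 already holds `c` while memory
  -- is still in stage `suc c`; the constant families in the premise express this mismatch.
  sweep : ∀ {P T} r (A B : ℕ → ℕ → Region) →
    (∀ {c σ} → c ℕ.< n → Sweep r (λ _ → A (suc c)) (λ _ → B (suc c)) c σ → Halts P σ T (Sweep r A B c)) →
    ∀ {σ} → Constants (reg σ) → reg σ 3 ≡ r → Layout (A n) (B n) (obj σ) →
    Halts (forEach 4 P) σ (suc (n ℕ.* suc (suc T) ℕ.+ 1)) (Sweep r A B 0)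
  sweep {P} {T} r A B body {σ} consts@(R0 , R2 , R10 , R11) R3 layout =
    sub 4 0 11 step loop 4 (Sweep r A B) (λ (_ , _ , _ , R4 , _) → R4) body′ n
      (consts , R3 , ℕₚ.≤-refl , reset R0 R11 , layout)
    where
    body′ : ∀ {c σ} → Sweep r A B (suc c) σ →
            Halts (instr (sub 4 4 2) ⨾ P) σ (suc T) (Sweep r A B c)
    body′ (consts@(_ , R2 , _) , R3 , c<n , R4 , layout) =
      sub 4 4 2 step body c<n (consts , R3 , ℕₚ.<⇒≤ c<n , decrement R4 R2 , layout)

  ∅ₙ : ℕ → Region
  ∅ₙ _ _ = ⊥

  initialise-halts : ∀ {σ r} → Constants (reg σ) → reg σ 3 ≡ r → Layout ∅ₙ ∅ₙ (obj σ) →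
    Halts initialise σ (suc (n ℕ.* 6 ℕ.+ 1))
      (λ τ → Constants (reg τ) × reg τ 3 ≡ r × Layout (Unions 0) (Unions 0) (obj τ))
  initialise-halts {r = r} consts R3 layout = weaken ℕₚ.≤-refl
    (λ (consts , R3 , _ , _ , layout) → consts , R3 ,
      layout-resp (λ _ → partial-end ∅ₙ (Unions 0) λ ()) (λ _ → partial-end ∅ₙ (Unions 0) λ ()) layout)
    (sweep r (Partial ∅ₙ (Unions 0)) (Partial ∅ₙ (Unions 0)) body consts R3
      (layout-resp (partial-start ∅ₙ (Unions 0)) (partial-start ∅ₙ (Unions 0)) layout))
    where
    body : ∀ {c σ} → c ℕ.< n →
      Sweep r (λ _ → Partial ∅ₙ (Unions 0) (suc c)) (λ _ → Partial ∅ₙ (Unions 0) (suc c)) c σ →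
      Halts _ σ 4 (Sweep r (Partial ∅ₙ (Unions 0)) (Partial ∅ₙ (Unions 0)) c)
    body {c} {⟨ R , M , Ω ⟩} c<n (consts@(R0 , _ , R10 , _) , R3 , c≤n , R4 , layout) =
      add 6 0 4 step add 7 10 4 step copyObj 6 4 step final (copyObj 7 4)
        (consts , R3 , c≤n , R4 ,
          write₂ (≡.cong₂ ℕ._+_ R10 R4) (source layout′) (partial-step ∅ₙ (Unions 0)) layout′)
      where
      source : ∀ {A B Ω} → Layout A B Ω → Ω (R 4) ≐ Partial ∅ₙ (Unions 0) c c
      source {Ω = Ω} layout = ≡.subst (λ a → Ω a ≐ Partial ∅ₙ (Unions 0) c c) (≡.sym R4)
        (≐-trans (proj₁ (layout c c<n)) (partial-here ∅ₙ (Unions 0) λ ()))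

      layout′ : Layout (Partial ∅ₙ (Unions 0) c) (Partial ∅ₙ (Unions 0) (suc c))
                       (Ω [ R 0 ℕ.+ R 4 ↦ Ω (R 4) ])
      layout′ = write₁ (≡.cong₂ ℕ._+_ R0 R4) c<n (source layout) (partial-step ∅ₙ (Unions 0)) layout

  commit-halts : ∀ {σ r j} → Constants (reg σ) → reg σ 3 ≡ r →
    Layout (Unions j) (Unions (suc j)) (obj σ) →
    Halts commit σ (suc (n ℕ.* 5 ℕ.+ 1))
      (λ τ → Constants (reg τ) × reg τ 3 ≡ r × Layout (Unions (suc j)) (Unions (suc j)) (obj τ))
  commit-halts {r = r} {j} consts R3 layout = weaken ℕₚ.≤-refl
    (λ (consts , R3 , _ , _ , layout) → consts , R3 ,
      layout-resp (λ _ → partial-end (Unions j) (Unions (suc j)) unions-mono) (λ _ → id , id) layout)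
    (sweep r A (λ _ → Unions (suc j)) body consts R3
      (layout-resp (partial-start (Unions j) (Unions (suc j))) (λ _ → id , id) layout))
    where
    A : ℕ → ℕ → Region
    A = Partial (Unions j) (Unions (suc j))

    body : ∀ {c σ} → c ℕ.< n → Sweep r (λ _ → A (suc c)) (λ _ → Unions (suc j)) c σ →
           Halts _ σ 3 (Sweep r A (λ _ → Unions (suc j)) c)
    body {c} {⟨ R , M , Ω ⟩} c<n (consts@(R0 , _ , R10 , _) , R3 , c≤n , R4 , layout) =
      add 6 0 4 step add 7 10 4 step final (copyObj 6 7)
        (consts , R3 , c≤n , R4 ,
          write₁ (≡.cong₂ ℕ._+_ R0 R4) c<n source (partial-step (Unions j) (Unions (suc j))) layout)
      where
      source : Ω (R 10 ℕ.+ R 4) ≐ A c c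
      source = ≡.subst (λ a → Ω a ≐ A c c) (≡.sym (≡.cong₂ ℕ._+_ R10 R4))
        (≐-trans (proj₂ (proj₂ (layout c c<n))) (partial-here (Unions j) (Unions (suc j)) unions-mono))

  -- State of the inner loop: the cell of `a` has absorbed the neighbours numbered `c` and above,
  -- and all other cells are as in `B`.
  Extended : (A B : ℕ → Region) → ℕ → ℕ → ℕ → Region
  Extended A B a c b x = x ∈ B b ⊎ (b ≡ a × ∃[ e ] c ℕ.≤ e × Adjacent a e × x ∈ A e)

  neighbours-halts : ∀ {σ r a} (A B : ℕ → Region) → a ℕ.< n →
    Constants (reg σ) → reg σ 3 ≡ r → reg σ 4 ≡ a → reg σ 7 ≡ n ℕ.+ n ℕ.+ a →
    Layout A B (obj σ) →
    Halts (forEach 5 (instr (add 9 0 5) ⨾ instr (adjacent 8 4 5) ⨾ ifnz 8 (instr (unionObj 7 7 9)) skip)) σ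
      (suc (n ℕ.* 6 ℕ.+ 1))
      (λ τ → Constants (reg τ) × reg τ 3 ≡ r × reg τ 4 ≡ a × Layout A (Extended A B a 0) (obj τ))
  neighbours-halts {r = r} {a} A B a<n consts@(R0 , _ , _ , R11) R3 R4 R7 layout =
    sub 5 0 11 step weaken ℕₚ.≤-refl
      (λ (consts , R3 , R4 , _ , _ , _ , layout) → consts , R3 , R4 , layout)
      (loop 5 Inv (λ (_ , _ , _ , _ , _ , R5 , _) → R5) body n
        (consts , R3 , R4 , R7 , ℕₚ.≤-refl , reset R0 R11 ,
          layout-resp (λ _ → id , id) (λ _ → start) layout))
    where
    Inv : ℕ → State → Set
    Inv c σ = Constants (reg σ) × reg σ 3 ≡ r × reg σ 4 ≡ a × reg σ 7 ≡ n ℕ.+ n ℕ.+ a ×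
              c ℕ.≤ n × reg σ 5 ≡ c × Layout A (Extended A B a c) (obj σ)

    start : ∀ {b} → B b ≐ Extended A B a n b
    start = inj₁ , [ id , (λ { (_ , _ , n≤e , (_ , v , _ , ≡.refl , _) , _) →
                              ⊥-elim (ℕₚ.<⇒≱ (Finₚ.toℕ<n v) n≤e) }) ]′

    -- The premise covers both uses: vertex `c` is not a neighbour of `a`, or the cell `b` is not
    -- the one being extended.
    extended-step : ∀ {c b} → (b ≡ a → ¬ Adjacent a c) → Extended A B a (suc c) b ≐ Extended A B a c b
    extended-step ¬adj =
      [ inj₁ , (λ (b≡a , e , c<e , rest) → inj₂ (b≡a , e , ℕₚ.<⇒≤ c<e , rest)) ]′ ,
      [ inj₁ , (λ (b≡a , e , c≤e , adj , x∈) → inj₂ (b≡a , e ,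
                 ℕₚ.≤∧≢⇒< c≤e (λ { ≡.refl → ¬adj b≡a adj }) , adj , x∈)) ]′

    extended-here : ∀ {c} → Adjacent a c → Extended A B a (suc c) a ∪ A c ≐ Extended A B a c a
    extended-here {c} adj =
      [ [ inj₁ , (λ (_ , e , c<e , rest) → inj₂ (≡.refl , e , ℕₚ.<⇒≤ c<e , rest)) ]′
      , (λ x∈ → inj₂ (≡.refl , c , ℕₚ.≤-refl , adj , x∈)) ]′ ,
      [ inj₁ ∘ inj₁ , split ]′
      where
      split : ∀ {x} → a ≡ a × (∃[ e ] c ℕ.≤ e × Adjacent a e × x ∈ A e) →
              x ∈ Extended A B a (suc c) a ⊎ x ∈ A c
      split (_ , e , c≤e , adj′ , x∈) with c ℕₚ.≟ e
      ... | yes ≡.refl = inj₂ x∈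
      ... | no  c≢e    = inj₁ (inj₂ (≡.refl , e , ℕₚ.≤∧≢⇒< c≤e c≢e , adj′ , x∈))

    body : ∀ {c σ} → Inv (suc c) σ → Halts _ σ 5 (Inv c)
    body {c} {⟨ R , M , Ω ⟩} (consts@(R0 , R2 , _) , R3 , R4 , R7 , c<n , R5 , layout) =
      sub 5 5 2 step add 9 0 5 step adjacent 8 4 5 step branch
      where
      R5′ : R 5 ℕ.∸ R 2 ≡ c
      R5′ = decrement R5 R2

      σ′ : State
      σ′ = exec G (adjacent 8 4 5) (exec G (add 9 0 5) (exec G (sub 5 5 2) ⟨ R , M , Ω ⟩))

      sum≐ : Ω (R 7) ∪ Ω (R 0 ℕ.+ (R 5 ℕ.∸ R 2)) ≐ Extended A B a (suc c) a ∪ A c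
      sum≐ rewrite R7 | R0 | R5′ with layout a a<n | layout c c<n
      ... | _ , _ , (f , g) | _ , (f′ , g′) , _ =
        [ inj₁ ∘ f , inj₂ ∘ f′ ]′ , [ inj₁ ∘ g , inj₂ ∘ g′ ]′

      branch : Halts (ifnz 8 (instr (unionObj 7 7 9)) skip) σ′ 2 (Inv c)
      branch with reg σ′ 8 ℕₚ.≟ 0
      ... | yes ≡0 = 2 , _ , if-zero ≡0 skip , ℕₚ.≤-refl ,
        (consts , R3 , R4 , R7 , ℕₚ.<⇒≤ c<n , R5′ ,
          layout-resp (λ _ → id , id) (λ _ → extended-step λ _ → ¬adj) layout)
        where
        ¬adj : ¬ Adjacent a c
        ¬adj = ≡.subst₂ (λ a c → ¬ Adjacent a c) R4 R5′ (truth≡0⇒ ≡0)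
      ... | no ≢0 = 2 , _ , if-nonzero ≢0 instr , ℕₚ.≤-refl ,
        (consts , R3 , R4 , R7 , ℕₚ.<⇒≤ c<n , R5′ ,
          write₂ R7 (≐-trans sum≐ (extended-here adj))
            (λ a≢b → extended-step λ b≡a → ⊥-elim (a≢b (≡.sym b≡a))) layout)
        where
        adj : Adjacent a c
        adj = ≡.subst₂ Adjacent R4 R5′ (truth≢0⇒ ≢0)

  -- A ball of radius `j + 1` is the ball of radius `j` together with those about the neighbours of
  -- its centre. Accumulating in the third block leaves the second at radius `j` for the whole
  -- sweep; in-place updates could mix radii.
  collect-halts : ∀ {σ r j} → Constants (reg σ) → reg σ 3 ≡ r →
    Layout (Unions j) (Unions j) (obj σ) →
    Halts collect σ (suc (n ℕ.* suc (suc (suc (suc (n ℕ.* 6 ℕ.+ 1)))) ℕ.+ 1))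
      (λ τ → Constants (reg τ) × reg τ 3 ≡ r × Layout (Unions j) (Unions (suc j)) (obj τ))
  collect-halts {r = r} {j} consts R3 layout = weaken ℕₚ.≤-refl
    (λ (consts , R3 , _ , _ , layout) → consts , R3 ,
      layout-resp (λ _ → id , id) (λ _ → partial-end (Unions j) (Unions (suc j)) unions-mono) layout)
    (sweep r (λ _ → Unions j) B body consts R3
      (layout-resp (λ _ → id , id) (partial-start (Unions j) (Unions (suc j))) layout))
    where
    B : ℕ → ℕ → Region
    B = Partial (Unions j) (Unions (suc j))

    body : ∀ {c σ} → c ℕ.< n → Sweep r (λ _ → Unions j) (λ _ → B (suc c)) c σ →
           Halts _ σ (suc (suc (n ℕ.* 6 ℕ.+ 1))) (Sweep r (λ _ → Unions j) B c)
    body {c} {⟨ R , M , Ω ⟩} c<n (consts@(_ , _ , R10 , _) , R3 , c≤n , R4 , layout) =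
      add 7 10 4 step weaken ℕₚ.≤-refl
        (λ (consts , R3 , R4 , layout) → consts , R3 , c≤n , R4 ,
          layout-resp (λ _ → id , id) (λ _ → extended≐) layout)
        (neighbours-halts (Unions j) (B (suc c)) c<n consts R3 R4 (≡.cong₂ ℕ._+_ R10 R4) layout)
      where
      extended≐ : ∀ {b} → Extended (Unions j) (B (suc c)) c 0 b ≐ B c b
      extended≐ {b} =
        [ [ inj₁ , (λ (c<b , x∈) → inj₂ (ℕₚ.<⇒≤ c<b , x∈)) ]′
        , (λ { (≡.refl , e , _ , adj , x∈) → inj₂ (ℕₚ.≤-refl , unions-cons adj x∈) }) ]′ ,
        [ inj₁ ∘ inj₁ , split ]′
        where
        split : ∀ {x} → c ℕ.≤ b × x ∈ Unions (suc j) b → x ∈ Extended (Unions j) (B (suc c)) c 0 b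
        split (c≤b , x∈) with c ℕₚ.≟ b
        ... | no  c≢b    = inj₁ (inj₂ (ℕₚ.≤∧≢⇒< c≤b c≢b , x∈))
        ... | yes ≡.refl with unions-uncons x∈
        ...   | inj₁ x∈′             = inj₁ (inj₁ x∈′)
        ...   | inj₂ (e , adj , x∈′) = inj₂ (≡.refl , e , z≤n , adj , x∈′)

  roundTime : ℕ
  roundTime = suc (suc (n ℕ.* suc (suc (suc (suc (n ℕ.* 6 ℕ.+ 1)))) ℕ.+ 1) ℕ.+ suc (n ℕ.* 5 ℕ.+ 1))

  rounds-halts : ∀ {σ} r → Constants (reg σ) → reg σ 3 ≡ r → Layout (Unions 0) (Unions 0) (obj σ) →
    Halts rounds σ (r ℕ.* suc roundTime ℕ.+ 1)
      (λ τ → Layout (Unions r) (Unions r) (obj τ))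
  rounds-halts r consts R3 layout = weaken ℕₚ.≤-refl
    (λ {τ} (_ , _ , j , j+0≡r , layout) →
      ≡.subst (λ j → Layout (Unions j) (Unions j) (obj τ))
        (≡.trans (≡.sym (ℕₚ.+-identityʳ j)) j+0≡r) layout)
    (loop 3 Inv (λ (_ , R3 , _) → R3) body r (consts , R3 , 0 , ≡.refl , layout))
    where
    -- `c` rounds remain and `j` are complete, so at `c = 0` the radius is exactly `r`.
    Inv : ℕ → State → Set
    Inv c σ = Constants (reg σ) × reg σ 3 ≡ c × ∃[ j ] j ℕ.+ c ≡ r × Layout (Unions j) (Unions j) (obj σ)

    body : ∀ {c σ} → Inv (suc c) σ → Halts _ σ roundTime (Inv c)
    body {c} (consts@(_ , R2 , _) , R3 , j , j+c≡r , layout) =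
      sub 3 3 2 step
      collect-halts consts (decrement R3 R2) layout then λ (consts , R3 , layout) →
      weaken ℕₚ.≤-refl
        (λ (consts , R3 , layout) → consts , R3 , suc j , ≡.trans (≡.sym (ℕₚ.+-suc j c)) j+c≡r , layout)
        (commit-halts consts R3 layout)

  initial-layout : ∀ k → Layout ∅ₙ ∅ₙ (obj (input k O))
  initial-layout k b b<n = low , empty (ℕₚ.m≤m+n n b) , empty (ℕₚ.≤-trans (ℕₚ.m≤m+n n n) (ℕₚ.m≤m+n _ b))
    where
    low : obj (input k O) b ≐ Unions 0 b
    low with b ℕₚ.<? n
    ... | no  b≮n  = ⊥-elim (b≮n b<n)
    ... | yes b<n′ =
      (λ x∈ → fromℕ< b<n′ , Finₚ.toℕ-fromℕ< b<n′ , _ , ball-centre 0 _ , x∈) ,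
      λ {x} (v , v≡b , u , u∈B , x∈u) → ≡.subst (λ w → x ∈ O w)
        (≡.sym (≡.trans (Finₚ.toℕ-injective (≡.trans (Finₚ.toℕ-fromℕ< b<n′) (≡.sym v≡b)))
                        (ball-zero u∈B))) x∈u

    empty : ∀ {e} → n ℕ.≤ e → obj (input k O) e ≐ (λ _ → ⊥)
    empty {e} n≤e with e ℕₚ.<? n
    ... | yes e<n = ⊥-elim (ℕₚ.<⇒≱ e<n n≤e)
    ... | no  _   = id , id

  program-halts : ∀ k → Halts ballUnionProgram (input k O) (evalPoly (7 ∷ 12 ∷ 10 ∷ 6 ∷ []) n)
    (λ σ → ∀ v → output n σ v ≐ BallUnion k v)
  program-halts k = weaken time≤ (λ {σ} → result {σ})
    (const 2 1 step add 10 0 0 step sub 3 0 1 step sub 3 0 3 step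
     initialise-halts (≡.refl , ≡.refl , ≡.refl , ≡.refl) ≡.refl (initial-layout k) then
     λ (consts , R3 , layout) → rounds-halts r consts R3 layout)
    where
    r : ℕ
    r = n ℕ.∸ (n ℕ.∸ k)

    result : ∀ {σ} → Layout (Unions r) (Unions r) (obj σ) → ∀ v → output n σ v ≐ BallUnion k v
    result layout v with layout (toℕ v) (Finₚ.toℕ<n v)
    ... | _ , (f , g) , _ =
      (λ x∈ → unname (f x∈)) , λ (u , u∈B , x∈u) → g (v , ≡.refl , u , ball-⊓ u∈B , x∈u)
      where
      unname : ∀ {x} → x ∈ Unions r (toℕ v) → x ∈ BallUnion k v
      unname (w , w≡v , u , u∈B , x∈u) with Finₚ.toℕ-injective w≡v
      ... | ≡.refl = u , ball-⊓⁻ u∈B , x∈u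

    time≤ : 4 ℕ.+ (suc (n ℕ.* 6 ℕ.+ 1) ℕ.+ (r ℕ.* suc roundTime ℕ.+ 1)) ℕ.≤
            evalPoly (7 ∷ 12 ∷ 10 ∷ 6 ∷ []) n
    -- The number of rounds `r` is at most `n`, and each round is quadratic in `n`; expanding the
    -- budget with `n` for `r` gives the coefficients.
    time≤ = ℕₚ.≤-trans
      (ℕₚ.+-monoʳ-≤ 4 (ℕₚ.+-monoʳ-≤ (suc (n ℕ.* 6 ℕ.+ 1))
        (ℕₚ.+-monoˡ-≤ 1 (ℕₚ.*-monoˡ-≤ (suc roundTime) (ℕₚ.m∸n≤m n (n ℕ.∸ k))))))
      (ℕₚ.≤-reflexive (solve 1 (λ n →
        con 4 :+ ((con 1 :+ (n :* con 6 :+ con 1)) :+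
          (n :* (con 2 :+ ((con 1 :+ (n :* (con 4 :+ (n :* con 6 :+ con 1)) :+ con 1)) :+
                           (con 1 :+ (n :* con 5 :+ con 1)))) :+ con 1))
        := con 7 :+ n :* (con 12 :+ n :* (con 10 :+ n :* (con 6 :+ n :* con 0)))) ≡.refl n))
      where open +-*-Solver

open import Data.Nat.Base using (_+_; _*_; _^_; _≤_)

theorem6p4 :
  (lem : ExcludedMiddle 0ℓ) (ℝ : CompleteOrderedField) →
  (d : ℕ) → 2 ≤ d → (c : CompleteOrderedField.Carrier ℝ) →
  let open CompleteOrderedField ℝ using (fromℕ) renaming (_*_ to _·_)
      open Euclidean ℝ d
      open Machine lem ℝ d
  in
  ((n : ℕ) (G : Graph n) (O : Family n) → IsFatRepresentation G c O →
    (k : ℕ) → 1 ≤ k →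
    ∃[ O′ ] IsFatRepresentation (power G (2 * k + 1))
        (fromℕ (3 ^ d * (2 * k + 1) ^ d) · c) O′)
  ×
  (Σ[ P ∈ Program ] Σ[ p ∈ List ℕ ]
    ((n : ℕ) (G : Graph n) (O : Family n) → IsFatRepresentation G c O →
      (k : ℕ) → 1 ≤ k →
      ∃[ t ] ∃[ σ ] Run G P (input k O) t σ × t ≤ evalPoly p n ×
        IsFatRepresentation (power G (2 * k + 1))
        (fromℕ (3 ^ d * (2 * k + 1) ^ d) · c) (output n σ)))
theorem6p4 lem ℝ d 2≤d c =
  -- The existence claim takes the output of the program as its witness, so a single verified
  -- construction proves both claims.
  (λ n G O fat k 1≤k → let (_ , σ , _ , _ , fat′) = computed n G O fat k in output n σ , fat′) ,
  ballUnionProgram , 7 ∷ 12 ∷ 10 ∷ 6 ∷ [] ,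
  (λ n G O fat k 1≤k → computed n G O fat k)
  where
  open Machine lem ℝ d
  open Euclidean ℝ d
  open CompleteOrderedField ℝ using (fromℕ) renaming (_*_ to _·_)

  1≤d : 1 ≤ d
  1≤d = ℕₚ.<⇒≤ 2≤d

  computed : (n : ℕ) (G : Graph n) (O : Family n) → IsFatRepresentation G c O → (k : ℕ) →
    ∃[ t ] ∃[ σ ] Run G ballUnionProgram (input k O) t σ ×
      t ≤ evalPoly (7 ∷ 12 ∷ 10 ∷ 6 ∷ []) n ×
      IsFatRepresentation (power G (2 * k + 1)) (fromℕ (3 ^ d * (2 * k + 1) ^ d) · c) (output n σ)
  computed n G O fat k =
    let (t , σ , run , t≤ , output≐) = Correctness.program-halts lem ℝ d 1≤d G O k
    in  t , σ , run , t≤ , BallUnions.O′-representation lem ℝ d 1≤d G O fat k (output n σ) output≐
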